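{- The $\mathrm{des}$-Wilf equivalence classes of quasi-consecutive patterns of lengths $2$, $3$ and $4$ are as follows. Length 2: there are exactly two classes, $\{\underline{1}2\}$ and $\{\underline{2}1\}$. Length 3: there are exactly five classes, $\{\underline{12}3\}$, $\{\underline{32}1\}$, $\{\underline{21}3\}$, $\{\underline{23}1\}$, $\{\underline{13}2,\underline{31}2\}$. Length 4: there are exactly fourteen classes: $\{\underline{312}4,\underline{231}4,\underline{241}3\}$, $\{\underline{213}4,\underline{132}4,\underline{142}3\}$, $\{\underline{243}1,\underline{324}1,\underline{314}2\}$, $\{\underline{342}1,\underline{423}1,\underline{413}2\}$, $\{\underline{134}2,\underline{124}3\}$, $\{\underline{431}2,\underline{421}3\}$, $\{\underline{123}4\}$, $\{\underline{321}4\}$, $\{\underline{214}3\}$, $\{\underline{412}3\}$, $\{\underline{143}2\}$, $\{\underline{341}2\}$, $\{\underline{234}1\}$, $\{\underline{432}1\}$. That is, two quasi-consecutive patterns of the same length ($2$, $3$ or $4$) are $\mathrm{des}$-Wilf equivalent if and only if they lie in the same listed class.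
   Context: $\mathfrak{S}_n$ is the set of permutations of $\{1,\ldots,n\}$ in one-line notation, and $\mathrm{des}(\pi)=|\{i\in[n-1]:\pi_i>\pi_{i+1}\}|$. A quasi-consecutive pattern of length $k$ is a permutation $\omega_1\cdots\omega_k\in\mathfrak{S}_k$ written $\underline{\omega_1\cdots\omega_{k-1}}\omega_k$. An occurrence of it in $\pi\in\mathfrak{S}_n$ is a subsequence $\pi_i\pi_{i+1}\cdots\pi_{i+k-2}\pi_j$ with $j>i+k-2$ that is order-isomorphic to $\omega_1\cdots\omega_k$ (the first $k-1$ letters are adjacent in $\pi$; the last need not be adjacent to them). $\mathfrak{S}_n(\omega)$ is the set of permutations in $\mathfrak{S}_n$ with no occurrence of $\omega$. Two patterns $\omega,\omega'$ are $\mathrm{des}$-Wilf equivalent, written $\omega\overset{\mathrm{des}}{\sim}\omega'$, if $|\{\pi\in\mathfrak{S}_n(\omega):\mathrm{des}(\pi)=m\}|=|\{\pi\in\mathfrak{S}_n(\omega'):\mathrm{des}(\pi)=m\}|$ for all $n\ge1$ and $m\ge0$. -}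

module Defs where

open import Data.Fin.Base as Fin using (Fin; zero; suc; toℕ; fromℕ; inject₁)
import Data.Fin.Properties as Fin
open import Data.List.Base as List using (List; []; _∷_; length; concat; filter; allFin; cartesianProductWith)
import Data.List.Relation.Unary.Any as List using (Any)
import Data.List.Membership.Propositional as List using (_∈_)
open import Data.Nat.Base using (ℕ; zero; suc; _+_; _≤_; _<_)
import Data.List.Relation.Unary.Unique.Propositional as List using (Unique)
import Data.List.Relation.Unary.Unique.DecPropositional as List using (unique?)
import Data.Nat.Properties as ℕ
open import Data.Product.Base using (_×_; _,_; ∃)
open import Data.Vec.Base as Vec using (Vec; []; _∷_; lookup; head)
open import Data.Vec.Properties using (≡-dec)
open import Data.Vec.Relation.Unary.AllPairs using (allPairs?)
open import Data.Vec.Relation.Unary.Unique.Propositional using (Unique)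
open import Function.Base using (_∘_)
open import Function.Bundles using (_⇔_; mk⇔; Equivalence)
open import Relation.Binary.PropositionalEquality using (_≡_; refl)
open import Relation.Nullary.Decidable using (Dec; toWitness; map′; _×-dec_; _→-dec_; ¬?)
open import Relation.Nullary.Negation using (¬_)
open import Relation.Unary using (Decidable)

-- A permutation of {1,…,n} is given by its one-line notation, a word of length
-- n with distinct letters.  Positions and letters are both counted from 0, so
-- that a letter a of the usual notation is the element a - 1 of Fin n.
Word : ℕ → Set
Word n = Vec (Fin n) n

IsPermutation : ∀ {n} → Word n → Set
IsPermutation π = Unique π

-- The letters of a word, renumbered as 1,…,n.
oneLine : ∀ {n} → Word n → Vec ℕ n
oneLine = Vec.map (suc ∘ toℕ)

Descent : ∀ {n} → Word (suc n) → Fin n → Set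
Descent π i = lookup π (suc i) Fin.< lookup π (inject₁ i)

descent? : ∀ {n} (π : Word (suc n)) → Decidable (Descent π)
descent? π i = lookup π (suc i) Fin.<? lookup π (inject₁ i)

des : ∀ {n} → Word n → ℕ
des {zero}  π = 0
des {suc n} π = length (filter (descent? π) (allFin n))

OrderIsomorphic : ∀ {k m n} → Vec (Fin m) k → Vec (Fin n) k → Set
OrderIsomorphic u v =
  ∀ a b → (lookup u a Fin.< lookup u b) ⇔ (lookup v a Fin.< lookup v b)

-- The positions p of an occurrence of a quasi-consecutive pattern of length
-- 2 + k are i, i+1, …, i+k, j with i+k < j, where i is the head of p.
QuasiConsecutive : ∀ {k n} → Vec (Fin n) (2 + k) → Set
QuasiConsecutive {k} p =
  (∀ (a : Fin (suc k)) → toℕ (lookup p (inject₁ a)) ≡ toℕ (head p) + toℕ a) ×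
  (toℕ (head p) + k < toℕ (lookup p (fromℕ (suc k))))

-- The length 2 + k covers all quasi-consecutive patterns with at least one
-- underlined letter.
IsOccurrence : ∀ {k n} → Word (2 + k) → Word n → Vec (Fin n) (2 + k) → Set
IsOccurrence ω π p = QuasiConsecutive p × OrderIsomorphic ω (Vec.map (lookup π) p)

Contains : ∀ {k n} → Word (2 + k) → Word n → Set
Contains ω π = ∃ (IsOccurrence ω π)

Avoids : ∀ {k n} → Word (2 + k) → Word n → Set
Avoids ω π = ¬ Contains ω π

-- The elements of { π ∈ 𝔖ₙ(ω) : des(π) = m }, as words.
AvoiderWithDes : ∀ {k n} → Word (2 + k) → ℕ → Word n → Set
AvoiderWithDes ω m π = IsPermutation π × Avoids ω π × des π ≡ m

isPermutation? : ∀ {n} → Decidable (IsPermutation {n})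
isPermutation? = allPairs? (λ x y → ¬? (x Fin.≟ y))

_⇔-dec_ : {A B : Set} → Dec A → Dec B → Dec (A ⇔ B)
A? ⇔-dec B? =
  map′ (λ (f , g) → mk⇔ f g) (λ e → Equivalence.to e , Equivalence.from e)
       ((A? →-dec B?) ×-dec (B? →-dec A?))

orderIsomorphic? : ∀ {k m n} (u : Vec (Fin m) k) (v : Vec (Fin n) k) → Dec (OrderIsomorphic u v)
orderIsomorphic? u v = Fin.all? λ a → Fin.all? λ b →
  (lookup u a Fin.<? lookup u b) ⇔-dec (lookup v a Fin.<? lookup v b)

quasiConsecutive? : ∀ {k n} → Decidable (QuasiConsecutive {k} {n})
quasiConsecutive? {k} p =
  Fin.all? (λ a → toℕ (lookup p (inject₁ a)) ℕ.≟ toℕ (head p) + toℕ a)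
  ×-dec (toℕ (head p) + k ℕ.<? toℕ (lookup p (fromℕ (suc k))))

anyVec? : ∀ {k n} {P : Vec (Fin n) k → Set} → Decidable P → Dec (∃ P)
anyVec? {zero}  P? = map′ ([] ,_) (λ { ([] , p) → p }) (P? [])
anyVec? {suc k} P? =
  map′ (λ (x , xs , p) → x ∷ xs , p) (λ { (x ∷ xs , p) → x , xs , p })
       (Fin.any? λ x → anyVec? λ xs → P? (x ∷ xs))

contains? : ∀ {k n} (ω : Word (2 + k)) (π : Word n) → Dec (Contains ω π)
contains? ω π = anyVec? λ p →
  quasiConsecutive? p ×-dec orderIsomorphic? ω (Vec.map (lookup π) p)

avoiderWithDes? : ∀ {k n} (ω : Word (2 + k)) m → Decidable (AvoiderWithDes {k} {n} ω m)
avoiderWithDes? ω m π = isPermutation? π ×-dec ¬? (contains? ω π) ×-dec (des π ℕ.≟ m)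

-- Every word of length k over Fin n, each listed exactly once.
allVecs : ∀ n k → List (Vec (Fin n) k)
allVecs n zero    = [] ∷ []
allVecs n (suc k) = cartesianProductWith _∷_ (allFin n) (allVecs n k)

-- The cardinality |{ π ∈ 𝔖ₙ(ω) : des(π) = m }|.
#avoiders : ∀ {k} → Word (2 + k) → ℕ → ℕ → ℕ
#avoiders ω n m = length (filter (avoiderWithDes? ω m) (allVecs n n))

_∼des_ : ∀ {k l} → Word (2 + k) → Word (2 + l) → Set
ω ∼des ω′ = ∀ n m → 1 ≤ n → #avoiders ω n m ≡ #avoiders ω′ n m

SameClass : ∀ {k} → List (List (Vec ℕ k)) → Word k → Word k → Set
SameClass classes ω ω′ =
  List.Any (λ C → (oneLine ω List.∈ C) × (oneLine ω′ List.∈ C)) classes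

-- As ∼des is reflexive, this also says that every permutation of length 2 + k
-- lies in one of the listed classes.
DesWilfClasses : ∀ k → List (List (Vec ℕ (2 + k))) → Set
DesWilfClasses k classes =
  (ω ω′ : Word (2 + k)) → IsPermutation ω → IsPermutation ω′ →
  (ω ∼des ω′) ⇔ SameClass classes ω ω′

-- The word w₁⋯wₖ stands for the pattern in which w₁,…,wₖ₋₁ are underlined.
classes₂ : List (List (Vec ℕ 2))
classes₂ =
    ((1 ∷ 2 ∷ []) ∷ [])
  ∷ ((2 ∷ 1 ∷ []) ∷ [])
  ∷ []

classes₃ : List (List (Vec ℕ 3))
classes₃ =
    ((1 ∷ 2 ∷ 3 ∷ []) ∷ [])
  ∷ ((3 ∷ 2 ∷ 1 ∷ []) ∷ [])
  ∷ ((2 ∷ 1 ∷ 3 ∷ []) ∷ [])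
  ∷ ((2 ∷ 3 ∷ 1 ∷ []) ∷ [])
  ∷ ((1 ∷ 3 ∷ 2 ∷ []) ∷ (3 ∷ 1 ∷ 2 ∷ []) ∷ [])
  ∷ []

classes₄ : List (List (Vec ℕ 4))
classes₄ =
    ((3 ∷ 1 ∷ 2 ∷ 4 ∷ []) ∷ (2 ∷ 3 ∷ 1 ∷ 4 ∷ []) ∷ (2 ∷ 4 ∷ 1 ∷ 3 ∷ []) ∷ [])
  ∷ ((2 ∷ 1 ∷ 3 ∷ 4 ∷ []) ∷ (1 ∷ 3 ∷ 2 ∷ 4 ∷ []) ∷ (1 ∷ 4 ∷ 2 ∷ 3 ∷ []) ∷ [])
  ∷ ((2 ∷ 4 ∷ 3 ∷ 1 ∷ []) ∷ (3 ∷ 2 ∷ 4 ∷ 1 ∷ []) ∷ (3 ∷ 1 ∷ 4 ∷ 2 ∷ []) ∷ [])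
  ∷ ((3 ∷ 4 ∷ 2 ∷ 1 ∷ []) ∷ (4 ∷ 2 ∷ 3 ∷ 1 ∷ []) ∷ (4 ∷ 1 ∷ 3 ∷ 2 ∷ []) ∷ [])
  ∷ ((1 ∷ 3 ∷ 4 ∷ 2 ∷ []) ∷ (1 ∷ 2 ∷ 4 ∷ 3 ∷ []) ∷ [])
  ∷ ((4 ∷ 3 ∷ 1 ∷ 2 ∷ []) ∷ (4 ∷ 2 ∷ 1 ∷ 3 ∷ []) ∷ [])
  ∷ ((1 ∷ 2 ∷ 3 ∷ 4 ∷ []) ∷ [])
  ∷ ((3 ∷ 2 ∷ 1 ∷ 4 ∷ []) ∷ [])
  ∷ ((2 ∷ 1 ∷ 4 ∷ 3 ∷ []) ∷ [])
  ∷ ((4 ∷ 1 ∷ 2 ∷ 3 ∷ []) ∷ [])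
  ∷ ((1 ∷ 4 ∷ 3 ∷ 2 ∷ []) ∷ [])
  ∷ ((3 ∷ 4 ∷ 1 ∷ 2 ∷ []) ∷ [])
  ∷ ((2 ∷ 3 ∷ 4 ∷ 1 ∷ []) ∷ [])
  ∷ ((4 ∷ 3 ∷ 2 ∷ 1 ∷ []) ∷ [])
  ∷ []

-- The listed classes are pairwise disjoint, and their numbers are 2, 5 and 14.
disjoint₂ : List.Unique (concat classes₂)
disjoint₂ = toWitness {a? = List.unique? (≡-dec ℕ._≟_) (concat classes₂)} _

disjoint₃ : List.Unique (concat classes₃)
disjoint₃ = toWitness {a? = List.unique? (≡-dec ℕ._≟_) (concat classes₃)} _

disjoint₄ : List.Unique (concat classes₄)
disjoint₄ = toWitness {a? = List.unique? (≡-dec ℕ._≟_) (concat classes₄)} _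

numbers : (length classes₂ ≡ 2) × (length classes₃ ≡ 5) × (length classes₄ ≡ 14)
numbers = refl , refl , refl

-- A permutation is encoded by its Lehmer code: the digit of a letter is its rank among
-- itself and the letters after it.  All letters other than the underlined ones come later,
-- so whether an occurrence of a pattern starts at a given place depends only on the
-- underlined digits there and on the number of digits that follow, and descents are
-- descents of the code.  For patterns of length 4, avoidance becomes a condition on all
-- triples a, b, c of consecutive digits, and the equivalences come from five sources.
--
-- * 231-4 and 241-3, and likewise 132-4 and 142-3, prescribe the height of the same peaks
--   b, in one case as maximal and in the other as minimal.  Changing the height at all
--   peaks is a bijection that keeps the descents.
-- * 134-2 and 124-3 force every weakly increasing run of digits to be x…xy, respectively
--   xy…y.
-- * A permutation avoids σ-4 if and only if the block before its largest letter avoids σ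
--   as a consecutive pattern and the rest avoids σ-4.  Reverse complements of blocks keep
--   the descents and exchange 231 with 312 and 132 with 213.
-- * Complements reverse the distribution of des.
-- * 31-2 is the complement of 13-2, and the permutations avoiding 31-2 are counted by the
--   Narayana numbers, which are symmetric.
--
-- The numbers of avoiders in 𝔖₂, 𝔖₄ and 𝔖₆ with one, one or two, and two or three descents
-- separate the classes of patterns of lengths 2, 3 and 4.

module Submission where

open import Defs
open import Data.Bool.Base using (true; false; if_then_else_)
open import Data.Empty using (⊥)
open import Data.Fin.Base as Fin using (Fin; zero; suc; toℕ; fromℕ; fromℕ<; inject₁; punchIn; punchOut; opposite)
open import Data.Fin.Patterns
open import Data.Fin.Properties as Fin using (toℕ-injective; toℕ<n; toℕ-fromℕ<; punchInᵢ≢i; punchIn-injective; punchIn-punchOut; opposite-prop; opposite-involutive)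
open import Data.Fin.Relation.Unary.Top using (view; ‵fromℕ; ‵inject₁)
open import Data.List.Base as List using (List; []; _∷_; _++_; _∷ʳ_; length; filter; allFin; tabulate; map; reverse; concatMap; upTo)
import Data.List.Membership.DecPropositional as DecMembership
open import Data.List.Membership.Propositional using (_∈_; find; lose)
open import Data.List.Membership.Propositional.Properties
open import Data.List.Properties as List
  using (length-++; map-tabulate; map-++; map-∘; map-cong; map-cong-local; map-id-local; reverse-involutive;
         reverse-++; unfold-reverse; reverse-map; ++-assoc; upTo-∷ʳ)
open import Data.List.Relation.Unary.All as All using (All; []; _∷_)
import Data.List.Relation.Unary.All.Properties as All
open import Data.List.Relation.Unary.AllPairs using ([]; _∷_)
open import Data.List.Relation.Unary.Any as Any using (Any; here; there; index)
import Data.List.Relation.Unary.Any.Properties as Any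
open import Data.List.Relation.Unary.Unique.Propositional using (Unique)
import Data.List.Relation.Unary.Unique.Propositional.Properties as Unique
open import Data.Nat.Base
open import Data.Nat.Combinatorics
  using (nCk+nC[k+1]≡[n+1]C[k+1]; nCk≡nC[n∸k]) renaming (_C_ to infixl 8 _C_)
open import Data.Nat.Combinatorics.Specification using (k>n⇒nCk≡0)
open import Data.Nat.ListAction using (sum)
open import Data.Nat.ListAction.Properties using (sum-++)
open import Data.Nat.Properties
open import Data.Nat.Tactic.RingSolver using (solve-∀)
open import Algebra.Properties.CommutativeSemigroup +-commutativeSemigroup using (interchange)
open import Data.Product.Base using (_×_; _,_; ∃; ∃₂; proj₁; proj₂)
open import Data.Product.Function.NonDependent.Propositional using (_×-⇔_)
open import Data.Product.Properties using () renaming (≡-dec to ×-≡-dec)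
open import Data.Sum.Base using (_⊎_; inj₁; inj₂; [_,_]′)
open import Data.Unit.Base using (⊤; tt)
open import Data.Vec.Base as Vec using (Vec; []; _∷_; lookup; head)
open import Data.Vec.Properties as Vec using (lookup-map)
open import Data.Vec.Relation.Unary.All as Allᵛ using ([]; _∷_) renaming (All to Allᵛ)
import Data.Vec.Relation.Unary.All.Properties as Allᵛ
open import Data.Vec.Relation.Unary.AllPairs using ([]; _∷_)
open import Data.Vec.Relation.Unary.Unique.Propositional using () renaming (Unique to Uniqueᵛ)
import Data.Vec.Relation.Unary.Unique.Propositional.Properties as Uniqueᵛ
open import Function.Base using (_∘_; id)
open import Function.Bundles using (_⇔_; mk⇔; Equivalence)
open import Function.Properties.Equivalence using () renaming (trans to ⇔-trans; sym to ⇔-sym; refl to ⇔-refl)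
open import Relation.Binary.Definitions using (tri<; tri≈; tri>)
open import Relation.Binary.PropositionalEquality
open import Relation.Nullary using (Dec; does; yes; no; ¬_; contradiction)
open import Relation.Nullary.Decidable using (True; toWitness; from-yes; map′; ¬?; _×-dec_; _→-dec_)
open import Relation.Unary using (Decidable)
open Equivalence using (to; from)

-- Reverse complement cannot be applied to whole permutations: it would move the free last letter of
-- a pattern to the front. It applies to the block before the largest letter because any copy of σ
-- inside that block is completed to σ-4 by the largest letter, so that only a condition on
-- consecutive letters remains. In a code, a letter is the largest of its suffix exactly when its
-- digit equals the number of digits after it. This locates the blocks, and it also turns 231-4 and
-- 132-4 into conditions on peak heights: at a peak the middle letter is the largest of the three,
-- and no letter exceeds it just when its digit is maximal. The free letter is a matter of values
-- only: a pattern is avoided at a place when its underlined letters leave no value of the required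
-- relative size. The least candidate for such a value is usually the right witness. Equalities of
-- counts are proved as two inequalities, each from an injective relation. The symmetry for 31-2 is
-- instead read off a closed formula. `#avoiders` filters all n^n words, which can be evaluated in
-- 𝔖₂ and 𝔖₄; the numbers for 𝔖₆ come from a generating tree of codes.

∈-skip : ∀ {A : Set} {y z : A} as {bs} → z ∈ as ++ y ∷ bs → z ≢ y → z ∈ as ++ bs
∈-skip as z∈ z≢y with ∈-++⁻ as z∈
... | inj₁ z∈as         = ∈-++⁺ˡ z∈as
... | inj₂ (here z≡y)   = contradiction z≡y z≢y
... | inj₂ (there z∈bs) = ∈-++⁺ʳ as z∈bs

-- Comparing finite cardinalities

Injects : {A B : Set} → (A → B → Set) → Set
Injects R = ∀ {x x′ y} → R x y → R x′ y → x ≡ x′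

-- The partner `y` of the first element is deleted from `ys`. By injectivity an element with the
-- same partner would equal the first one, so the other elements keep their partners.
length-≤ : {A B : Set} {R : A → B → Set} → Injects R → ∀ {xs ys} → Unique xs →
           (∀ {x} → x ∈ xs → ∃ λ y → y ∈ ys × R x y) → length xs ≤ length ys
length-≤ inj {[]} _ _ = z≤n
length-≤ {R = R} inj {x ∷ xs} (x∉xs ∷ xs!) total with total (here refl)
... | y , y∈ys , Rxy with ∈-∃++ y∈ys
... | as , bs , refl = begin
  suc (length xs)             ≤⟨ s≤s (length-≤ inj xs! total′) ⟩
  suc (length (as ++ bs))     ≡⟨ cong suc (length-++ as) ⟩
  suc (length as + length bs) ≡⟨ +-suc (length as) (length bs) ⟨
  length as + suc (length bs) ≡⟨ length-++ as ⟨
  length (as ++ y ∷ bs)       ∎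
  where
  open ≤-Reasoning
  total′ : ∀ {x′} → x′ ∈ xs → ∃ λ y′ → y′ ∈ as ++ bs × R x′ y′
  total′ x′∈xs with total (there x′∈xs)
  ... | y′ , y′∈ys , Rx′y′ = y′ , ∈-skip as y′∈ys y′≢y , Rx′y′
    where
    y′≢y : y′ ≢ y
    y′≢y refl = All.lookup x∉xs x′∈xs (inj Rxy Rx′y′)

count-≤ : {A B : Set} {R : A → B → Set} {P : A → Set} {Q : B → Set}
          (P? : Decidable P) (Q? : Decidable Q) → Injects R →
          ∀ {xs ys} → Unique xs →
          (∀ {x} → x ∈ xs → P x → ∃ λ y → y ∈ ys × Q y × R x y) →
          length (filter P? xs) ≤ length (filter Q? ys)
count-≤ {R = R} {Q = Q} P? Q? inj {xs} {ys} xs! total =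
  length-≤ inj (Unique.filter⁺ P? xs!) total′
  where
  total′ : ∀ {x} → x ∈ filter P? xs → ∃ λ y → y ∈ filter Q? ys × R x y
  total′ x∈ with ∈-filter⁻ P? x∈
  ... | x∈xs , Px with total x∈xs Px
  ... | y , y∈ys , Qy , Rxy = y , ∈-filter⁺ Q? y∈ys Qy , Rxy

allVecs-complete : ∀ n k (v : Vec (Fin n) k) → v ∈ allVecs n k
allVecs-complete n zero    []      = here refl
allVecs-complete n (suc k) (x ∷ v) =
  ∈-cartesianProductWith⁺ _∷_ (∈-allFin x) (allVecs-complete n k v)

allVecs-unique : ∀ n k → Unique (allVecs n k)
allVecs-unique n zero    = All.[] ∷ []
allVecs-unique n (suc k) =
  Unique.cartesianProductWith⁺ _∷_ Vec.∷-injective (Unique.allFin⁺ n) (allVecs-unique n k)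

-- Lehmer codes

data Code : ℕ → Set where
  []  : Code 0
  _∷_ : ∀ {n} → Fin (suc n) → Code n → Code (suc n)

-- The later letters are first written as a permutation of their own; `punchIn d` then opens a gap
-- at the value d of the first letter.
word : ∀ {n} → Code n → Word n
word []      = []
word (d ∷ e) = d ∷ Vec.map (punchIn d) (word e)

digits : ∀ {n} → Code n → List ℕ
digits []      = []
digits (d ∷ e) = toℕ d ∷ digits e

-- Codes as plain lists of numbers, so that maps on them can be defined without carrying the bounds
-- along.
data Valid : ℕ → List ℕ → Set where
  []  : Valid 0 []
  _∷_ : ∀ {n d ds} → d ≤ n → Valid n ds → Valid (suc n) (d ∷ ds)

digits-valid : ∀ {n} (e : Code n) → Valid n (digits e)
digits-valid []      = []
digits-valid (d ∷ e) = s≤s⁻¹ (toℕ<n d) ∷ digits-valid e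

digits-injective : ∀ {n} (e e′ : Code n) → digits e ≡ digits e′ → e ≡ e′
digits-injective []      []        _  = refl
digits-injective (d ∷ e) (d′ ∷ e′) eq with List.∷-injective eq
... | d≡d′ , e≡e′ = cong₂ _∷_ (toℕ-injective d≡d′) (digits-injective e e′ e≡e′)

code : ∀ {n ds} → Valid n ds → ∃ λ (e : Code n) → digits e ≡ ds
code []        = [] , refl
code (d≤n ∷ v) with code v
... | e , refl = fromℕ< (s≤s d≤n) ∷ e , cong (_∷ _) (toℕ-fromℕ< (s≤s d≤n))

length-valid : ∀ {n ds} → Valid n ds → length ds ≡ n
length-valid []      = refl
length-valid (_ ∷ v) = cong suc (length-valid v)

word-isPermutation : ∀ {n} (e : Code n) → IsPermutation (word e)
word-isPermutation []      = []
word-isPermutation (d ∷ e) =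
  Allᵛ.map⁺ (Allᵛ.universal (λ x d≡x → punchInᵢ≢i d x (sym d≡x)) (word e)) ∷
  Uniqueᵛ.map⁺ (punchIn-injective d _ _) (word-isPermutation e)

unpunch : ∀ {n k} (x : Fin (suc n)) (xs : Vec (Fin (suc n)) k) → Allᵛ (x ≢_) xs →
          ∃ λ ys → Vec.map (punchIn x) ys ≡ xs
unpunch x []       []          = [] , refl
unpunch x (y ∷ xs) (x≢y ∷ x∉) with unpunch x xs x∉
... | ys , refl = punchOut x≢y ∷ ys , cong (_∷ _) (punchIn-punchOut x≢y)

unique-map⁻ : ∀ {A B : Set} {n} (f : A → B) (xs : Vec A n) → Uniqueᵛ (Vec.map f xs) → Uniqueᵛ xs
unique-map⁻ f []       []         = []
unique-map⁻ f (x ∷ xs) (x∉ ∷ xs!) =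
  Allᵛ.map (λ fx≢fy x≡y → fx≢fy (cong f x≡y)) (Allᵛ.map⁻ x∉) ∷ unique-map⁻ f xs xs!

encode : ∀ {n} (π : Word n) → IsPermutation π → ∃ λ e → word e ≡ π
encode []       []          = [] , refl
encode (x ∷ xs) (x∉ ∷ xs!) with unpunch x xs x∉
... | ys , refl with encode ys (unique-map⁻ (punchIn x) ys xs!)
... | e , refl = x ∷ e , refl

map-injective : ∀ {A B : Set} {f : A → B} → (∀ {x y} → f x ≡ f y → x ≡ y) →
                ∀ {n} (xs ys : Vec A n) → Vec.map f xs ≡ Vec.map f ys → xs ≡ ys
map-injective inj []       []       _  = refl
map-injective inj (x ∷ xs) (y ∷ ys) eq with Vec.∷-injective eq
... | fx≡fy , eqs = cong₂ _∷_ (inj fx≡fy) (map-injective inj xs ys eqs)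

word-injective : ∀ {n} (e e′ : Code n) → word e ≡ word e′ → e ≡ e′
word-injective []      []        _  = refl
word-injective (d ∷ e) (d′ ∷ e′) eq with Vec.∷-injective eq
... | refl , eqs = cong (d ∷_) (word-injective e e′ (map-injective (punchIn-injective d _ _) _ _ eqs))

-- This lets the last letter of an occurrence be specified by its value alone.
word-surjective : ∀ {n} (e : Code n) (x : Fin n) → ∃ λ i → lookup (word e) i ≡ x
word-surjective (d ∷ e) x with d Fin.≟ x
... | yes d≡x = zero , d≡x
... | no  d≢x with word-surjective e (punchOut d≢x)
... | i , eq = suc i , trans (lookup-map i (punchIn d) (word e))
                         (trans (cong (punchIn d) eq) (punchIn-punchOut d≢x))

-- Descents

ind : ∀ {A : Set} → Dec A → ℕ
ind A? = if does A? then 1 else 0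

ind-cong : ∀ {A B : Set} (A? : Dec A) (B? : Dec B) → A ⇔ B → ind A? ≡ ind B?
ind-cong (yes _) (yes _) _   = refl
ind-cong (no  _) (no  _) _   = refl
ind-cong (yes a) (no ¬b) A⇔B = contradiction (to A⇔B a) ¬b
ind-cong (no ¬a) (yes b) A⇔B = contradiction (from A⇔B b) ¬a

ind-no : ∀ {A : Set} (A? : Dec A) → ¬ A → ind A? ≡ 0
ind-no (yes a) ¬a = contradiction a ¬a
ind-no (no _)  _  = refl

ind-yes : ∀ {A : Set} (A? : Dec A) → A → ind A? ≡ 1
ind-yes (yes _) _ = refl
ind-yes (no ¬a) a = contradiction a ¬a

ind-exclusive : ∀ {A B : Set} (A? : Dec A) (B? : Dec B) → (A → ¬ B) → (¬ B → A) → ind A? + ind B? ≡ 1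
ind-exclusive (yes a) (yes b) excl _   = contradiction b (excl a)
ind-exclusive (yes _) (no _)  _    _   = refl
ind-exclusive (no _)  (yes _) _    _   = refl
ind-exclusive (no ¬a) (no ¬b) _    exh = contradiction (exh ¬b) ¬a

descents : List ℕ → ℕ
descents []           = 0
descents (a ∷ [])     = 0
descents (a ∷ b ∷ ds) = ind (b <? a) + descents (b ∷ ds)

desᵛ : ∀ {m n} → Vec (Fin m) n → ℕ
desᵛ []          = 0
desᵛ (x ∷ [])    = 0
desᵛ (x ∷ y ∷ v) = ind (y Fin.<? x) + desᵛ (y ∷ v)

length-filter-map : ∀ {A B : Set} {P : B → Set} (P? : Decidable P) (f : A → B) xs →
                    length (filter P? (List.map f xs)) ≡ length (filter (P? ∘ f) xs)
length-filter-map P? f []       = refl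
length-filter-map P? f (x ∷ xs) with does (P? (f x))
... | true  = cong suc (length-filter-map P? f xs)
... | false = length-filter-map P? f xs

length-filter-∷ : ∀ {A : Set} {P : A → Set} (P? : Decidable P) x xs →
                  length (filter P? (x ∷ xs)) ≡ ind (P? x) + length (filter P? xs)
length-filter-∷ P? x xs with does (P? x)
... | true  = refl
... | false = refl

des-desᵛ : ∀ {m n} (v : Vec (Fin m) (suc n)) →
           length (filter (λ i → lookup v (suc i) Fin.<? lookup v (inject₁ i)) (allFin n)) ≡ desᵛ v
des-desᵛ (x ∷ [])    = refl
des-desᵛ {n = suc n} v@(x ∷ y ∷ w) = begin
  length (filter D? (allFin (suc n)))                  ≡⟨ length-filter-∷ D? zero (tabulate suc) ⟩
  ind (y Fin.<? x) + length (filter D? (tabulate suc)) ≡⟨ cong (λ l → ind (y Fin.<? x) + length (filter D? l)) (map-tabulate id suc) ⟨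
  ind (y Fin.<? x) + length (filter D? (List.map suc (allFin n))) ≡⟨ cong (ind (y Fin.<? x) +_) (length-filter-map D? suc (allFin n)) ⟩
  ind (y Fin.<? x) + length (filter (D? ∘ suc) (allFin n)) ≡⟨ cong (ind (y Fin.<? x) +_) (des-desᵛ (y ∷ w)) ⟩
  desᵛ v ∎
  where
  open ≡-Reasoning
  D? : (i : Fin (suc n)) → Dec (lookup v (suc i) Fin.< lookup v (inject₁ i))
  D? i = lookup v (suc i) Fin.<? lookup v (inject₁ i)

shift : ℕ → ℕ → ℕ
shift d x with x <? d
... | yes _ = x
... | no  _ = suc x

toℕ-punchIn : ∀ {n} (d : Fin (suc n)) (x : Fin n) → toℕ (punchIn d x) ≡ shift (toℕ d) (toℕ x)
toℕ-punchIn zero    x       = refl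
toℕ-punchIn (suc d) zero    = refl
toℕ-punchIn (suc d) (suc x) = trans (cong suc (toℕ-punchIn d x)) (shift-suc (toℕ d) (toℕ x))
  where
  shift-suc : ∀ d x → suc (shift d x) ≡ shift (suc d) (suc x)
  shift-suc d x with x <? d | suc x <? suc d
  ... | yes _   | yes _     = refl
  ... | no  _   | no  _     = refl
  ... | yes x<d | no  x≮d   = contradiction (s≤s x<d) x≮d
  ... | no  x≮d | yes x<d   = contradiction (s≤s⁻¹ x<d) x≮d

shift-< : ∀ {d x} → x < d → shift d x ≡ x
shift-< {d} {x} x<d with x <? d
... | yes _   = refl
... | no  x≮d = contradiction x<d x≮d

shift-≥ : ∀ {d x} → d ≤ x → shift d x ≡ suc x
shift-≥ {d} {x} d≤x with x <? d
... | yes x<d = contradiction d≤x (<⇒≱ x<d)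
... | no  _   = refl

shift-mono-< : ∀ d {x y} → x < y → shift d x < shift d y
shift-mono-< d {x} {y} x<y with x <? d | y <? d
... | yes _   | yes _   = x<y
... | yes _   | no  _   = m≤n⇒m≤1+n x<y
... | no  x≮d | yes y<d = contradiction (<-trans x<y y<d) x≮d
... | no  _   | no  _   = s≤s x<y

shift-cancel-< : ∀ d {x y} → shift d x < shift d y → x < y
shift-cancel-< d {x} {y} lt with <-cmp x y
... | tri< x<y _ _    = x<y
... | tri≈ _ refl _   = contradiction lt (<-irrefl refl)
... | tri> _ _ y<x    = contradiction (shift-mono-< d y<x) (<-asym lt)

-- `shift d` skips the value d, so comparing a later letter with the first one amounts to comparing
-- x with d; equality of digits counts as an ascent. Hence the descents of a word are those of its
-- code.
shift<⇔ : ∀ d x → shift d x < d ⇔ x < d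
shift<⇔ d x with x <? d
... | yes x<d = mk⇔ (λ _ → x<d) id
... | no  x≮d = mk⇔ (λ 1+x<d → <-trans (n<1+n x) 1+x<d) (λ x<d → contradiction x<d x≮d)

shift>⇔ : ∀ d x → d < shift d x ⇔ d ≤ x
shift>⇔ d x with x <? d
... | yes x<d = mk⇔ <⇒≤ (λ d≤x → contradiction d≤x (<⇒≱ x<d))
... | no  x≮d = mk⇔ (λ _ → ≮⇒≥ x≮d) s≤s

punchIn-<⇔ : ∀ {n} (d : Fin (suc n)) (x y : Fin n) → x Fin.< y ⇔ punchIn d x Fin.< punchIn d y
punchIn-<⇔ d x y = mk⇔
  (λ x<y → subst₂ _<_ (sym (toℕ-punchIn d x)) (sym (toℕ-punchIn d y)) (shift-mono-< (toℕ d) x<y))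
  (λ lt → shift-cancel-< (toℕ d) (subst₂ _<_ (toℕ-punchIn d x) (toℕ-punchIn d y) lt))

desᵛ-map : ∀ {m n} (d : Fin (suc m)) (v : Vec (Fin m) n) → desᵛ (Vec.map (punchIn d) v) ≡ desᵛ v
desᵛ-map d []          = refl
desᵛ-map d (x ∷ [])    = refl
desᵛ-map d (x ∷ y ∷ v) =
  cong₂ _+_ (ind-cong (_ Fin.<? _) (_ Fin.<? _) (⇔-sym (punchIn-<⇔ d y x))) (desᵛ-map d (y ∷ v))

desᵛ-word : ∀ {n} (e : Code n) → desᵛ (word e) ≡ descents (digits e)
desᵛ-word []          = refl
desᵛ-word (a ∷ [])    = refl
desᵛ-word (a ∷ e@(b ∷ _)) = cong₂ _+_
  (ind-cong (punchIn a b Fin.<? a) (toℕ b <? toℕ a)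
    (subst (λ t → t < toℕ a ⇔ toℕ b < toℕ a) (sym (toℕ-punchIn a b)) (shift<⇔ (toℕ a) (toℕ b))))
  (trans (desᵛ-map a (word e)) (desᵛ-word e))

des-word : ∀ {n} (e : Code n) → des (word e) ≡ descents (digits e)
des-word []      = refl
des-word e@(_ ∷ _) = trans (des-desᵛ (word e)) (desᵛ-word e)

-- Occurrences

HeadContains : ∀ {k n} → Word (2 + k) → Word n → Set
HeadContains ω π = ∃ λ p → IsOccurrence ω π p × toℕ (head p) ≡ 0

orderIsomorphic-suc : ∀ {k n} (ω : Word k) (d : Fin (suc n)) (e : Code n) (p : Vec (Fin n) k) →
  OrderIsomorphic ω (Vec.map (lookup (word e)) p) ⇔
  OrderIsomorphic ω (Vec.map (lookup (word (d ∷ e))) (Vec.map suc p))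
orderIsomorphic-suc ω d e p = mk⇔
  (λ iso a b → ⇔-trans (iso a b) (same a b))
  (λ iso a b → ⇔-trans (iso a b) (⇔-sym (same a b)))
  where
  eq : ∀ a → lookup (Vec.map (lookup (word (d ∷ e))) (Vec.map suc p)) a ≡
             punchIn d (lookup (Vec.map (lookup (word e)) p) a)
  eq a = begin
    lookup (Vec.map (lookup (word (d ∷ e))) (Vec.map suc p)) a ≡⟨ lookup-map a _ (Vec.map suc p) ⟩
    lookup (word (d ∷ e)) (lookup (Vec.map suc p) a)           ≡⟨ cong (lookup (word (d ∷ e))) (lookup-map a suc p) ⟩
    lookup (Vec.map (punchIn d) (word e)) (lookup p a)         ≡⟨ lookup-map (lookup p a) (punchIn d) (word e) ⟩
    punchIn d (lookup (word e) (lookup p a))                   ≡⟨ cong (punchIn d) (lookup-map a (lookup (word e)) p) ⟨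
    punchIn d (lookup (Vec.map (lookup (word e)) p) a)         ∎
    where open ≡-Reasoning
  same : ∀ a b → lookup (Vec.map (lookup (word e)) p) a Fin.< lookup (Vec.map (lookup (word e)) p) b ⇔
                 lookup (Vec.map (lookup (word (d ∷ e))) (Vec.map suc p)) a Fin.<
                 lookup (Vec.map (lookup (word (d ∷ e))) (Vec.map suc p)) b
  same a b = subst₂ (λ x y → _ ⇔ x Fin.< y) (sym (eq a)) (sym (eq b)) (punchIn-<⇔ d _ _)

quasiConsecutive-suc : ∀ {k n} (p : Vec (Fin n) (2 + k)) →
                       QuasiConsecutive p ⇔ QuasiConsecutive (Vec.map suc p)
quasiConsecutive-suc {k} p@(_ ∷ _) = mk⇔
  (λ (adj , last) → (λ a → trans (cong toℕ (lookup-map (inject₁ a) suc p)) (cong suc (adj a)))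
                  , subst (suc (toℕ (head p)) + k <_) (sym (cong toℕ (lookup-map (fromℕ (suc k)) suc p))) (s≤s last))
  (λ (adj , last) → (λ a → suc-injective (trans (sym (cong toℕ (lookup-map (inject₁ a) suc p))) (adj a)))
                  , s≤s⁻¹ (subst (suc (toℕ (head p)) + k <_) (cong toℕ (lookup-map (fromℕ (suc k)) suc p)) last))

allSuc : ∀ {n k} (p : Vec (Fin (suc n)) k) → (∀ j → 0 < toℕ (lookup p j)) → ∃ λ q → Vec.map suc q ≡ p
allSuc []          _   = [] , refl
allSuc (zero  ∷ p) pos = contradiction (pos zero) λ ()
allSuc (suc x ∷ p) pos with allSuc p (pos ∘ suc)
... | q , refl = x ∷ q , refl

quasiConsecutive-pos : ∀ {k n} (p : Vec (Fin n) (2 + k)) → QuasiConsecutive p →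
                       0 < toℕ (head p) → ∀ j → 0 < toℕ (lookup p j)
quasiConsecutive-pos p (adj , last) pos j with view j
... | ‵fromℕ     = ≤-<-trans z≤n last
... | ‵inject₁ a = ≤-trans pos (≤-trans (m≤m+n _ (toℕ a)) (≤-reflexive (sym (adj a))))

-- No position of an occurrence precedes its head, so if the head is not 0 then all positions are
-- successors and the occurrence lies in the tail, whose relative order `punchIn d` keeps.
contains-∷ : ∀ {k n} (ω : Word (2 + k)) d (e : Code n) →
             Contains ω (word (d ∷ e)) ⇔ (HeadContains ω (word (d ∷ e)) ⊎ Contains ω (word e))
contains-∷ ω d e = mk⇔ split join
  where
  split : Contains ω (word (d ∷ e)) → HeadContains ω (word (d ∷ e)) ⊎ Contains ω (word e)
  split (p , qc , iso) with toℕ (head p) ≟ 0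
  ... | yes ≡0 = inj₁ (p , (qc , iso) , ≡0)
  ... | no  ≢0 with allSuc p (quasiConsecutive-pos p qc (n≢0⇒n>0 ≢0))
  ... | q , refl = inj₂ (q , from (quasiConsecutive-suc q) qc , from (orderIsomorphic-suc ω d e q) iso)
  join : HeadContains ω (word (d ∷ e)) ⊎ Contains ω (word e) → Contains ω (word (d ∷ e))
  join (inj₁ (p , occ , _))     = p , occ
  join (inj₂ (q , (qc , iso))) = Vec.map suc q , to (quasiConsecutive-suc q) qc , to (orderIsomorphic-suc ω d e q) iso

-- Avoidance as a local condition on digits

record Isoℕ {k} (ω : Word k) (v : Vec ℕ k) : Set where
  constructor mkIso
  field iso : ∀ a b → (lookup ω a Fin.< lookup ω b) ⇔ (lookup v a < lookup v b)

open Isoℕ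

isoℕ : ∀ {k n} (ω : Word k) (v : Vec (Fin n) k) → OrderIsomorphic ω v ⇔ Isoℕ ω (Vec.map toℕ v)
isoℕ ω v = mk⇔
  (λ i → mkIso λ a b → subst₂ (λ x y → _ ⇔ x < y) (sym (lookup-map a toℕ v)) (sym (lookup-map b toℕ v)) (i a b))
  (λ i a b → subst₂ (λ x y → _ ⇔ x < y) (lookup-map a toℕ v) (lookup-map b toℕ v) (iso i a b))

iso-≢ : ∀ {k} {ω : Word k} → IsPermutation ω → ∀ {v} → Isoℕ ω v → ∀ {a b} → a ≢ b → lookup v a ≢ lookup v b
iso-≢ {ω = ω} ω! {v} i {a} {b} a≢b eq with Fin.<-cmp (lookup ω a) (lookup ω b)
... | tri< lt _ _ = <-irrefl eq (to (iso i a b) lt)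
... | tri≈ _ e _  = a≢b (Uniqueᵛ.lookup-injective ω! a b e)
... | tri> _ _ gt = <-irrefl (sym eq) (to (iso i b a) gt)

-- The first argument of R is the number of digits that follow.
Pairs : (ℕ → ℕ → ℕ → Set) → List ℕ → Set
Pairs R (a ∷ b ∷ ds) = R (length ds) a b × Pairs R (b ∷ ds)
Pairs R _            = ⊤

Triples : (ℕ → ℕ → ℕ → ℕ → Set) → List ℕ → Set
Triples R (a ∷ b ∷ c ∷ ds) = R (length ds) a b c × Triples R (b ∷ c ∷ ds)
Triples R _                = ⊤

-- Here x ranges over values and not over positions: every value other than the underlined letters
-- occurs after them. The word in question has 2 + r letters, whence the bound.
NoHead₃ : Word 3 → ℕ → ℕ → ℕ → Set
NoHead₃ ω r a b = ¬ ∃ λ x → x < 2 + r × Isoℕ ω (a ∷ shift a b ∷ x ∷ [])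

NoHead₄ : Word 4 → ℕ → ℕ → ℕ → ℕ → Set
NoHead₄ ω r a b c = ¬ ∃ λ x → x < 3 + r × Isoℕ ω (a ∷ shift a b ∷ shift a (shift b c) ∷ x ∷ [])

toℕ-punchIn² : ∀ {n} (a : Fin (2 + n)) (b : Fin (suc n)) (c : Fin n) →
               toℕ (punchIn a (punchIn b c)) ≡ shift (toℕ a) (shift (toℕ b) (toℕ c))
toℕ-punchIn² a b c = trans (toℕ-punchIn a (punchIn b c)) (cong (shift (toℕ a)) (toℕ-punchIn b c))

Characterises : ∀ {k} → (List ℕ → Set) → Word (2 + k) → Set
Characterises S ω = ∀ {n} (e : Code n) → Avoids ω (word e) ⇔ S (digits e)

¬-cong-⇔ : ∀ {A B : Set} → A ⇔ B → (¬ A) ⇔ (¬ B)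
¬-cong-⇔ A⇔B = mk⇔ (λ ¬a b → ¬a (from A⇔B b)) (λ ¬b a → ¬b (to A⇔B a))

avoids-∷ : ∀ {k n} (ω : Word (2 + k)) d (e : Code n) →
           Avoids ω (word (d ∷ e)) ⇔ (¬ HeadContains ω (word (d ∷ e)) × Avoids ω (word e))
avoids-∷ ω d e = mk⇔
  (λ avoids → avoids ∘ from (contains-∷ ω d e) ∘ inj₁ , avoids ∘ from (contains-∷ ω d e) ∘ inj₂)
  (λ (¬head , avoids) → [ ¬head , avoids ]′ ∘ to (contains-∷ ω d e))

avoids-[] : ∀ {k} (ω : Word (2 + k)) → Avoids ω []
avoids-[] ω (() ∷ _ , _)

short : ∀ {k n} (ω : Word (2 + k)) (π : Word n) → n ≤ suc k → ¬ HeadContains ω π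
short {k} ω π n≤1+k (p , ((_ , last) , _) , _) =
  <⇒≱ (toℕ<n (lookup p (fromℕ (suc k)))) (≤-trans n≤1+k (≤-<-trans (m≤n+m k _) last))

module _ (ω : Word 3) (ω! : IsPermutation ω) where

  head₃ : ∀ {r} (a : Fin (2 + r)) (b : Fin (suc r)) (e : Code r) →
          HeadContains ω (word (a ∷ b ∷ e)) ⇔
          (∃ λ x → x < 2 + r × Isoℕ ω (toℕ a ∷ shift (toℕ a) (toℕ b) ∷ x ∷ []))
  head₃ {r} a b e = mk⇔ f g
    where
    π = word (a ∷ b ∷ e)
    f : HeadContains ω π → _
    f (p₀ ∷ p₁ ∷ p₂ ∷ [] , ((adj , last) , iso) , h)
      with toℕ-injective {j = 0F} h | toℕ-injective {j = 1F} (trans (adj 1F) (cong (_+ 1) h))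
    ... | refl | refl = toℕ x , toℕ<n x ,
      subst (λ t → Isoℕ ω (toℕ a ∷ t ∷ toℕ x ∷ [])) (toℕ-punchIn a b) (to (isoℕ ω (Vec.map (lookup π) q)) iso)
      where
      x = lookup π p₂
      q = 0F ∷ 1F ∷ p₂ ∷ []
    g : _ → HeadContains ω π
    g (x , x<n , iso) with word-surjective (a ∷ b ∷ e) (fromℕ< x<n)
    ... | i , eq = 0F ∷ 1F ∷ i ∷ [] , (((λ { 0F → refl ; 1F → refl }) , last i eq) , iso′) , refl
      where
      -- The isomorphism makes x differ from both underlined letters, so x stands at neither of
      -- their positions.
      last : ∀ i → lookup π i ≡ fromℕ< x<n → 1 < toℕ i
      last 0F            eq = contradiction (trans (cong toℕ eq) (toℕ-fromℕ< x<n)) (iso-≢ ω! iso {0F} {2F} λ ())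
      last 1F            eq = contradiction (trans (sym (toℕ-punchIn a b)) (trans (cong toℕ eq) (toℕ-fromℕ< x<n))) (iso-≢ ω! iso {1F} {2F} λ ())
      last (suc (suc _)) _  = s≤s (s≤s z≤n)
      iso′ : OrderIsomorphic ω (Vec.map (lookup π) (0F ∷ 1F ∷ i ∷ []))
      iso′ = from (isoℕ ω (Vec.map (lookup π) (0F ∷ 1F ∷ i ∷ [])))
        (subst₂ (λ t y → Isoℕ ω (toℕ a ∷ t ∷ y ∷ [])) (sym (toℕ-punchIn a b))
                (sym (trans (cong toℕ eq) (toℕ-fromℕ< x<n))) iso)

  characterises₃ : Characterises (Pairs (NoHead₃ ω)) ω
  characterises₃ []          = mk⇔ _ (λ _ → avoids-[] ω)
  characterises₃ (a ∷ [])    = mk⇔ _ (λ _ → from (avoids-∷ ω a []) (short ω (word (a ∷ [])) (s≤s z≤n) , avoids-[] ω))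
  characterises₃ (a ∷ b ∷ e) = ⇔-trans (avoids-∷ ω a (b ∷ e))
    (subst (λ l → (¬ HeadContains ω (word (a ∷ b ∷ e)) × Avoids ω (word (b ∷ e))) ⇔ (NoHead₃ ω l _ _ × Pairs (NoHead₃ ω) (digits (b ∷ e)))) (sym (length-valid (digits-valid e)))
      (¬-cong-⇔ (head₃ a b e) ×-⇔ characterises₃ (b ∷ e)))

module _ (ω : Word 4) (ω! : IsPermutation ω) where

  head₄ : ∀ {r} (a : Fin (3 + r)) (b : Fin (2 + r)) (c : Fin (suc r)) (e : Code r) →
          HeadContains ω (word (a ∷ b ∷ c ∷ e)) ⇔
          (∃ λ x → x < 3 + r × Isoℕ ω (toℕ a ∷ shift (toℕ a) (toℕ b) ∷ shift (toℕ a) (shift (toℕ b) (toℕ c)) ∷ x ∷ []))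
  head₄ {r} a b c e = mk⇔ f g
    where
    π = word (a ∷ b ∷ c ∷ e)
    f : HeadContains ω π → _
    f (p₀ ∷ p₁ ∷ p₂ ∷ p₃ ∷ [] , ((adj , last) , iso) , h)
      with toℕ-injective {j = 0F} h | toℕ-injective {j = 1F} (trans (adj 1F) (cong (_+ 1) h))
         | toℕ-injective {j = 2F} (trans (adj 2F) (cong (_+ 2) h))
    ... | refl | refl | refl = toℕ x , toℕ<n x ,
      subst₂ (λ s t → Isoℕ ω (toℕ a ∷ s ∷ t ∷ toℕ x ∷ [])) (toℕ-punchIn a b) (toℕ-punchIn² a b c) (to (isoℕ ω (Vec.map (lookup π) q)) iso)
      where
      x = lookup π p₃
      q = 0F ∷ 1F ∷ 2F ∷ p₃ ∷ []
    g : _ → HeadContains ω π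
    g (x , x<n , iso) with word-surjective (a ∷ b ∷ c ∷ e) (fromℕ< x<n)
    ... | i , eq = 0F ∷ 1F ∷ 2F ∷ i ∷ [] , (((λ { 0F → refl ; 1F → refl ; 2F → refl }) , last i (trans (cong toℕ eq) (toℕ-fromℕ< x<n))) , iso′) , refl
      where
      last : ∀ i → toℕ (lookup π i) ≡ x → 2 < toℕ i
      last 0F                  eq = contradiction eq (iso-≢ ω! iso {0F} {3F} λ ())
      last 1F                  eq = contradiction (trans (sym (toℕ-punchIn a b)) eq) (iso-≢ ω! iso {1F} {3F} λ ())
      last 2F                  eq = contradiction (trans (sym (toℕ-punchIn² a b c)) eq) (iso-≢ ω! iso {2F} {3F} λ ())
      last (suc (suc (suc _))) _  = s≤s (s≤s (s≤s z≤n))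
      iso′ : OrderIsomorphic ω (Vec.map (lookup π) (0F ∷ 1F ∷ 2F ∷ i ∷ []))
      iso′ = from (isoℕ ω (Vec.map (lookup π) (0F ∷ 1F ∷ 2F ∷ i ∷ [])))
        (subst₂ (λ v y → Isoℕ ω (toℕ a ∷ lookup v 0F ∷ lookup v 1F ∷ y ∷ []))
                {x = shift (toℕ a) (toℕ b) ∷ shift (toℕ a) (shift (toℕ b) (toℕ c)) ∷ []}
                (cong₂ (λ s t → s ∷ t ∷ []) (sym (toℕ-punchIn a b)) (sym (toℕ-punchIn² a b c)))
                (sym (trans (cong toℕ eq) (toℕ-fromℕ< x<n))) iso)

  characterises₄ : Characterises (Triples (NoHead₄ ω)) ω
  characterises₄ []          = mk⇔ _ (λ _ → avoids-[] ω)
  characterises₄ (a ∷ [])    = mk⇔ _ (λ _ → from (avoids-∷ ω a []) (short ω (word (a ∷ [])) (s≤s z≤n) , avoids-[] ω))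
  characterises₄ (a ∷ b ∷ []) = mk⇔ _ (λ _ → from (avoids-∷ ω a (b ∷ []))
    (short ω (word (a ∷ b ∷ [])) (s≤s (s≤s z≤n)) , from (avoids-∷ ω b []) (short ω (word (b ∷ [])) (s≤s z≤n) , avoids-[] ω)))
  characterises₄ (a ∷ b ∷ c ∷ e) = ⇔-trans (avoids-∷ ω a (b ∷ c ∷ e))
    (subst (λ l → (¬ HeadContains ω (word (a ∷ b ∷ c ∷ e)) × Avoids ω (word (b ∷ c ∷ e))) ⇔ (NoHead₄ ω l _ _ _ × Triples (NoHead₄ ω) (digits (b ∷ c ∷ e)))) (sym (length-valid (digits-valid e)))
      (¬-cong-⇔ (head₄ a b c e) ×-⇔ characterises₄ (b ∷ c ∷ e)))

-- From relations between codes to equivalences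

module _ {S T : List ℕ → Set} {R : List ℕ → List ℕ → Set} (inj : Injects R)
         (total : ∀ {n ds} → Valid n ds → S ds →
                  ∃ λ es → Valid n es × T es × descents es ≡ descents ds × R ds es) where

  #avoiders-≤ : ∀ {k l} {ω : Word (2 + k)} {ω′ : Word (2 + l)} → Characterises S ω → Characterises T ω′ →
                ∀ n m → #avoiders ω n m ≤ #avoiders ω′ n m
  #avoiders-≤ {ω = ω} {ω′} S≈ω T≈ω′ n m =
    count-≤ (avoiderWithDes? ω m) (avoiderWithDes? ω′ m) inj′ (allVecs-unique n n) total′
    where
    Rʷ : Word n → Word n → Set
    Rʷ π ρ = ∃₂ λ d e → word d ≡ π × word e ≡ ρ × R (digits d) (digits e)
    inj′ : Injects Rʷ
    inj′ (d , e , refl , refl , Rde) (d′ , e′ , refl , eq , Rd′e′) with word-injective e′ e eq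
    ... | refl with digits-injective d d′ (inj Rde Rd′e′)
    ... | refl = refl
    total′ : ∀ {π} → π ∈ allVecs n n → AvoiderWithDes ω m π →
             ∃ λ ρ → ρ ∈ allVecs n n × AvoiderWithDes ω′ m ρ × Rʷ π ρ
    total′ _ (π! , avoids , des≡m) with encode _ π!
    ... | d , refl with total (digits-valid d) (to (S≈ω d) avoids)
    ... | es , v , Tes , des≡ , Rde with code v
    ... | e , refl = word e , allVecs-complete n n (word e) ,
      (word-isPermutation e , from (T≈ω′ e) Tes ,
       trans (des-word e) (trans des≡ (trans (sym (des-word d)) des≡m))) ,
      d , e , refl , refl , Rde

-- One such relation in each direction gives equal counts by antisymmetry; no compatibility between
-- the two has to be shown. Allowing relations instead of maps lets the flip of blocks be an
-- inductive family.
record _≼_ (S T : List ℕ → Set) : Set₁ where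
  field
    relates : List ℕ → List ℕ → Set
    injects : Injects relates
    total   : ∀ {n ds} → Valid n ds → S ds →
              ∃ λ es → Valid n es × T es × descents es ≡ descents ds × relates ds es

∼des-from-≼ : ∀ {S T k l} {ω : Word (2 + k)} {ω′ : Word (2 + l)} → S ≼ T → T ≼ S →
              Characterises S ω → Characterises T ω′ → ω ∼des ω′
∼des-from-≼ {ω = ω} {ω′} S≼T T≼S S≈ω T≈ω′ n m _ = ≤-antisym
  (#avoiders-≤ (S≼T ._≼_.injects) (S≼T ._≼_.total) {ω = ω} {ω′} S≈ω T≈ω′ n m)
  (#avoiders-≤ (T≼S ._≼_.injects) (T≼S ._≼_.total) {ω = ω′} {ω} T≈ω′ S≈ω n m)

≼-by : ∀ {S T} (f g : List ℕ → List ℕ) →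
       (∀ {n ds} → Valid n ds → S ds → Valid n (f ds) × T (f ds) × descents (f ds) ≡ descents ds) →
       (∀ {n ds} → Valid n ds → S ds → g (f ds) ≡ ds) → S ≼ T
≼-by f g image inverse = record
  -- The graph of g read backwards, so that injectivity is immediate.
  { relates = λ ds es → g es ≡ ds
  ; injects = λ p q → trans (sym p) q
  ; total   = λ v s → f _ , image v s .proj₁ , image v s .proj₂ .proj₁ , image v s .proj₂ .proj₂ , inverse v s
  }

triples-⇔ : ∀ {R R′} → (∀ {r a b c} → a ≤ 2 + r → b ≤ 1 + r → c ≤ r → R r a b c ⇔ R′ r a b c) →
            ∀ {n ds} → Valid n ds → Triples R ds ⇔ Triples R′ ds
triples-⇔ R⇔R′ [] = ⇔-refl
triples-⇔ R⇔R′ (_ ∷ []) = ⇔-refl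
triples-⇔ R⇔R′ (_ ∷ _ ∷ []) = ⇔-refl
triples-⇔ {R} {R′} R⇔R′ (_∷_ {d = a} a≤ v@(_∷_ {d = b} b≤ (_∷_ {d = c} {ds} c≤ w))) =
  subst (λ l → R l a b c ⇔ R′ l a b c) (sym (length-valid w)) (R⇔R′ a≤ b≤ c≤)
  ×-⇔ triples-⇔ R⇔R′ v

valid-head : ∀ {n d ds} → Valid n (d ∷ ds) → d ≤ length ds
valid-head (d≤ ∷ v) = ≤-trans d≤ (≤-reflexive (sym (length-valid v)))

-- Peaks

-- Since c < b ≥ a, neither neighbour of the middle digit b of a peak is itself the middle
-- digit of a peak, so that the peaks of a code can be changed independently.
module Peaks (C : ℕ → ℕ → Set) (C? : ∀ a c → Dec (C a c)) where

  Peak : ℕ → ℕ → ℕ → Set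
  Peak a b c = c < b × a ≤ b × C a c

  Peak? : ∀ a b c → Dec (Peak a b c)
  Peak? a b c = c <? b ×-dec a ≤? b ×-dec C? a c

  -- The height of a peak is prescribed by its two neighbours and the number r of digits after them.
  -- None of these changes when other peaks are changed.
  Height : Set
  Height = ℕ → ℕ → ℕ → ℕ

  Admissible : Height → Set
  Admissible v = ∀ {r a b c} → c ≤ r → b ≤ suc r → Peak a b c → Peak a (v r a c) c × v r a c ≤ suc r

  AtHeight : Height → ℕ → ℕ → ℕ → ℕ → Set
  AtHeight v r a b c = Peak a b c → b ≡ v r a c

  raise : Height → ℕ → ℕ → ℕ → ℕ → ℕ
  raise v r a b c with Peak? a b c
  ... | yes _ = v r a c
  ... | no  _ = b

  raise-peak : ∀ v r {a b c} → Peak a b c → raise v r a b c ≡ v r a c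
  raise-peak v r {a} {b} {c} p with Peak? a b c
  ... | yes _ = refl
  ... | no ¬p = contradiction p ¬p

  raise-¬peak : ∀ v r {a b c} → ¬ Peak a b c → raise v r a b c ≡ b
  raise-¬peak v r {a} {b} {c} ¬p with Peak? a b c
  ... | yes p = contradiction p ¬p
  ... | no  _ = refl

  -- All peaks change simultaneously: the recursion passes on the original b, not the raised one.
  raiseAll′ : Height → ℕ → List ℕ → List ℕ
  raiseAll′ v a (b ∷ c ∷ ds) = raise v (length ds) a b c ∷ raiseAll′ v b (c ∷ ds)
  raiseAll′ v a ds           = ds

  raiseAll : Height → List ℕ → List ℕ
  raiseAll v []       = []
  raiseAll v (a ∷ ds) = a ∷ raiseAll′ v a ds

  length-raiseAll′ : ∀ v a ds → length (raiseAll′ v a ds) ≡ length ds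
  length-raiseAll′ v a []           = refl
  length-raiseAll′ v a (b ∷ [])     = refl
  length-raiseAll′ v a (b ∷ c ∷ ds) = cong suc (length-raiseAll′ v b (c ∷ ds))

  -- a and a′ are the letter before ds, before and after raising.
  Before : ℕ → ℕ → List ℕ → Set
  Before a a′ []      = ⊤
  Before a a′ (b ∷ _) = a′ ≡ a ⊎ (b < a × b < a′)

  module _ {v : Height} (adm : Admissible v) where

    -- This re-establishes `Before` one place further on: a digit that changes is a peak, and so
    -- exceeds c before and after the change.
    raise-before : ∀ {r a b c} → c ≤ r → b ≤ suc r →
                   raise v r a b c ≡ b ⊎ (c < b × c < raise v r a b c)
    raise-before {r} {a} {b} {c} c≤ b≤ with Peak? a b c
    ... | yes p = inj₂ (proj₁ p , proj₁ (proj₁ (adm c≤ b≤ p)))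
    ... | no  _ = inj₁ refl

    -- The counterpart for the left neighbour: a peak is at least a before and after the change.
    raise-after : ∀ {r a b c} → c ≤ r → b ≤ suc r →
                  raise v r a b c ≡ b ⊎ (a ≤ b × a ≤ raise v r a b c)
    raise-after {r} {a} {b} {c} c≤ b≤ with Peak? a b c
    ... | yes p = inj₂ (proj₁ (proj₂ p) , proj₁ (proj₂ (proj₁ (adm c≤ b≤ p))))
    ... | no  _ = inj₁ refl

    raise-≤ : ∀ {r a b c} → c ≤ r → b ≤ suc r → raise v r a b c ≤ suc r
    raise-≤ {r} {a} {b} {c} c≤ b≤ with Peak? a b c
    ... | yes p = proj₂ (adm c≤ b≤ p)
    ... | no  _ = b≤

    valid-raiseAll′ : ∀ {n a ds} → Valid n ds → Valid n (raiseAll′ v a ds)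
    valid-raiseAll′ []          = []
    valid-raiseAll′ (b≤ ∷ [])   = b≤ ∷ []
    valid-raiseAll′ {a = a} (_∷_ {d = b} b≤ w@(_∷_ {d = c} {ds} _ u)) =
      subst (raise v (length ds) a b c ≤_) (cong suc (length-valid u)) (raise-≤ (valid-head w) (valid-head (b≤ ∷ w))) ∷ valid-raiseAll′ w

    raiseAll′-∷ : ∀ {n} a b ds → Valid n (b ∷ ds) → ∃₂ λ b′ es → raiseAll′ v a (b ∷ ds) ≡ b′ ∷ es ×
                  (b′ ≡ b ⊎ (a ≤ b × a ≤ b′)) × length es ≡ length ds
    raiseAll′-∷ a b []       _ = b , [] , refl , inj₁ refl , refl
    raiseAll′-∷ a b (c ∷ ds) (b≤ ∷ w) =
      _ , _ , refl , raise-after (valid-head w) (valid-head (b≤ ∷ w)) , length-raiseAll′ v b (c ∷ ds)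

    raise-descent : ∀ {r a a′ b c} → c ≤ r → b ≤ suc r → a′ ≡ a ⊎ (b < a × b < a′) →
                    ind (raise v r a b c <? a′) ≡ ind (b <? a)
    raise-descent {r} {a} {a′} {b} {c} c≤ b≤ bef with Peak? a b c | bef
    ... | no _  | inj₁ refl         = refl
    ... | no _  | inj₂ (b<a , b<a′) = ind-cong (b <? a′) (b <? a) (mk⇔ (λ _ → b<a) (λ _ → b<a′))
    ... | yes p | inj₁ refl         = ind-cong (v r a c <? a) (b <? a)
      (mk⇔ (λ lt → contradiction (proj₁ (proj₂ (proj₁ (adm c≤ b≤ p)))) (<⇒≱ lt))
           (λ lt → contradiction (proj₁ (proj₂ p)) (<⇒≱ lt)))
    ... | yes p | inj₂ (b<a , _)    = contradiction (proj₁ (proj₂ p)) (<⇒≱ b<a)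

    descents-raiseAll′ : ∀ {n a a′ ds} → Valid n ds → Before a a′ ds →
                         descents (a′ ∷ raiseAll′ v a ds) ≡ descents (a ∷ ds)
    descents-raiseAll′ [] bef = refl
    descents-raiseAll′ (b≤ ∷ []) (inj₁ refl) = refl
    descents-raiseAll′ {a = a} {a′} (_∷_ {d = b} b≤ []) (inj₂ (b<a , b<a′)) =
      cong (_+ 0) (ind-cong (b <? a′) (b <? a) (mk⇔ (λ _ → b<a) (λ _ → b<a′)))
    descents-raiseAll′ (b≤ ∷ w@(_ ∷ _)) bef =
      cong₂ _+_ (raise-descent (valid-head w) (valid-head (b≤ ∷ w)) bef)
                (descents-raiseAll′ w (raise-before (valid-head w) (valid-head (b≤ ∷ w))))

    -- A neighbour that may have changed is itself a peak, so it forces b < a or b ≤ c, and b is not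
    -- a peak. These inequalities survive the change, so no new peak arises at b either.
    raised-peak : ∀ {r a a′ b c c′} → c ≤ r → b ≤ suc r →
                  a′ ≡ a ⊎ (b < a × b < a′) → c′ ≡ c ⊎ (b ≤ c × b ≤ c′) →
                  (∃ λ (p : Peak a b c) → a′ ≡ a × c′ ≡ c × raise v r a b c ≡ v r a c) ⊎
                  (¬ Peak a b c × ¬ Peak a′ (raise v r a b c) c′ × raise v r a b c ≡ b)
    raised-peak {r} {a} {a′} {b} {c} {c′} c≤ b≤ bef aft with Peak? a b c | bef | aft
    ... | yes p | inj₂ (b<a , _) | _              = contradiction (proj₁ (proj₂ p)) (<⇒≱ b<a)
    ... | yes p | _              | inj₂ (b≤c , _) = contradiction b≤c (<⇒≱ (proj₁ p))
    ... | yes p | inj₁ a′≡a      | inj₁ c′≡c      = inj₁ (p , a′≡a , c′≡c , refl)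
    ... | no ¬p | bef            | aft            = inj₂ (¬p , ¬p′ bef aft , refl)
      where
      ¬p′ : a′ ≡ a ⊎ (b < a × b < a′) → c′ ≡ c ⊎ (b ≤ c × b ≤ c′) → ¬ Peak a′ b c′
      ¬p′ (inj₂ (_ , b<a′)) _                 (_ , a′≤b , _) = <⇒≱ b<a′ a′≤b
      ¬p′ _                 (inj₂ (_ , b≤c′)) (c′<b , _)     = <⇒≱ c′<b b≤c′
      ¬p′ (inj₁ refl)       (inj₁ refl)       p              = ¬p p

    atHeight-raiseAll′ : ∀ {n a a′ ds} → Valid n ds → Before a a′ ds →
                         Triples (AtHeight v) (a′ ∷ raiseAll′ v a ds)
    atHeight-raiseAll′ [] bef = tt
    atHeight-raiseAll′ (b≤ ∷ []) bef = tt
    atHeight-raiseAll′ {a = a} {a′} (_∷_ {d = b} b≤ w@(_∷_ {d = c} {ds} _ _)) bef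
      with raiseAll′ v b (c ∷ ds) | raiseAll′-∷ b c ds w
         | atHeight-raiseAll′ w (raise-before {a = a} (valid-head w) (valid-head (b≤ ∷ w)))
    ... | _ | c′ , es , refl , aft , len | rest rewrite len = first , rest
      where
      first : AtHeight v (length ds) a′ (raise v (length ds) a b c) c′
      first p with raised-peak (valid-head w) (valid-head (b≤ ∷ w)) bef aft
      ... | inj₁ (_ , refl , refl , eq) = eq
      ... | inj₂ (_ , ¬p′ , _)          = contradiction p ¬p′

    module _ {u : Height} (adm′ : Admissible u) where

      -- At a peak the second change writes `u r a c`, computed from unchanged neighbours, and
      -- `AtHeight u` says that this is the original digit.
      raiseAll′-inverse : ∀ {n a a′ ds} → Valid n ds → Before a a′ ds → Triples (AtHeight u) (a ∷ ds) →
                          raiseAll′ u a′ (raiseAll′ v a ds) ≡ ds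
      raiseAll′-inverse [] bef _ = refl
      raiseAll′-inverse (b≤ ∷ []) bef _ = refl
      raiseAll′-inverse {a = a} {a′} (_∷_ {d = b} b≤ w@(_∷_ {d = c} {ds} _ _)) bef (h , t)
        with raiseAll′ v b (c ∷ ds) | raiseAll′-∷ b c ds w
           | raiseAll′-inverse w (raise-before {a = a} (valid-head w) (valid-head (b≤ ∷ w))) t
      ... | _ | c′ , es , refl , aft , len | rest = cong₂ _∷_ first rest
        where
        first : raise u (length es) a′ (raise v (length ds) a b c) c′ ≡ b
        first rewrite len with raised-peak (valid-head w) (valid-head (b≤ ∷ w)) bef aft
        ... | inj₂ (_ , ¬p′ , eq) = trans (raise-¬peak u _ ¬p′) eq
        ... | inj₁ (p , refl , refl , eq) rewrite eq =
          trans (raise-peak u _ (proj₁ (adm (valid-head w) (valid-head (b≤ ∷ w)) p))) (sym (h p))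

  atHeight-≼ : ∀ {u v} → Admissible u → Admissible v → Triples (AtHeight u) ≼ Triples (AtHeight v)
  atHeight-≼ {u} {v} adm-u adm-v = ≼-by (raiseAll v) (raiseAll u) image inverse
    where
    bef : ∀ {a} ds → Before a a ds
    bef []      = tt
    bef (_ ∷ _) = inj₁ refl
    image : ∀ {n ds} → Valid n ds → Triples (AtHeight u) ds →
            Valid n (raiseAll v ds) × Triples (AtHeight v) (raiseAll v ds) × descents (raiseAll v ds) ≡ descents ds
    image []                _ = [] , tt , refl
    image (_∷_ {ds = ds} a≤ w) _ = a≤ ∷ valid-raiseAll′ adm-v w , atHeight-raiseAll′ adm-v w (bef ds) ,
                                   descents-raiseAll′ adm-v w (bef ds)
    inverse : ∀ {n ds} → Valid n ds → Triples (AtHeight u) ds → raiseAll u (raiseAll v ds) ≡ ds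
    inverse []                   _ = refl
    inverse (_∷_ {ds = ds} a≤ w) s = cong (_ ∷_) (raiseAll′-inverse adm-v adm-u w (bef ds) s)

-- Weakly increasing runs

-- LateRise says that every weakly increasing run has the form x…xy, and EarlyRise that it
-- has the form xy…y.
LateRise EarlyRise : List ℕ → Set
LateRise  = Triples λ _ a b c → ¬ (a < b × b ≤ c)
EarlyRise = Triples λ _ a b c → ¬ (a ≤ b × b < c)

weak? : ∀ a b c → Dec (a ≤ b × b ≤ c)
weak? a b c = a ≤? b ×-dec b ≤? c

-- Applied from the right end, this carries the last digit y of a run x...xy leftwards and yields
-- xy...y. Bounds are respected since they grow towards the left.
pull : ℕ → List ℕ → List ℕ
pull a (b ∷ c ∷ ds) with weak? a b c
... | yes _ = c ∷ c ∷ ds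
... | no  _ = b ∷ c ∷ ds
pull a ds = ds

pullAll : List ℕ → List ℕ
pullAll []       = []
pullAll (a ∷ ds) = a ∷ pull a (pullAll ds)

runStart : ℕ → ℕ → ℕ → ℕ
runStart a b c with weak? a b c
... | yes _ = a
... | no  _ = b

-- Works from the left: the first digit x of a run overwrites all later ones except the last. Since
-- a ≤ b, the bound on b also holds for a.
push : ℕ → List ℕ → List ℕ
push a (b ∷ c ∷ ds) = let b′ = runStart a b c in b′ ∷ push b′ (c ∷ ds)
push a ds           = ds

pushAll : List ℕ → List ℕ
pushAll []       = []
pushAll (a ∷ ds) = a ∷ push a ds

valid-pull : ∀ {n a ds} → Valid n ds → Valid n (pull a ds)
valid-pull [] = []
valid-pull (b≤ ∷ []) = b≤ ∷ []
valid-pull {a = a} (_∷_ {d = b} b≤ (_∷_ {d = c} c≤ v)) with weak? a b c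
... | yes _ = m≤n⇒m≤1+n c≤ ∷ c≤ ∷ v
... | no  _ = b≤ ∷ c≤ ∷ v

valid-pullAll : ∀ {n ds} → Valid n ds → Valid n (pullAll ds)
valid-pullAll []       = []
valid-pullAll (a≤ ∷ v) = a≤ ∷ valid-pull (valid-pullAll v)

descents-pull : ∀ a ds → descents (a ∷ pull a ds) ≡ descents (a ∷ ds)
descents-pull a []           = refl
descents-pull a (b ∷ [])     = refl
descents-pull a (b ∷ c ∷ ds) with weak? a b c
... | no  _           = refl
... | yes (a≤b , b≤c) = cong₂ _+_
  (trans (ind-no (c <? a) (≤⇒≯ (≤-trans a≤b b≤c))) (sym (ind-no (b <? a) (≤⇒≯ a≤b))))
  (cong (_+ descents (c ∷ ds)) (trans (ind-no (c <? c) (<-irrefl refl)) (sym (ind-no (c <? b) (≤⇒≯ b≤c)))))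

descents-pullAll : ∀ ds → descents (pullAll ds) ≡ descents ds
descents-pullAll []           = refl
descents-pullAll (a ∷ [])     = refl
descents-pullAll (a ∷ ds@(b ∷ _)) =
  trans (descents-pull a (pullAll ds)) (cong (ind (b <? a) +_) (descents-pullAll ds))

earlyRise-pull : ∀ a ds → EarlyRise ds → EarlyRise (a ∷ pull a ds)
earlyRise-pull a []           _ = tt
earlyRise-pull a (b ∷ [])     _ = tt
earlyRise-pull a (b ∷ c ∷ []) _ with weak? a b c
... | yes _ = (λ (_ , c<c) → <-irrefl refl c<c) , tt
... | no ¬w = (λ (a≤b , b<c) → ¬w (a≤b , <⇒≤ b<c)) , tt
earlyRise-pull a (b ∷ c ∷ d ∷ ds) (h , t) with weak? a b c
... | yes (_ , b≤c) = (λ (_ , c<c) → <-irrefl refl c<c) , (λ (_ , c<d) → h (b≤c , c<d)) , t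
... | no ¬w         = (λ (a≤b , b<c) → ¬w (a≤b , <⇒≤ b<c)) , h , t

earlyRise-pullAll : ∀ ds → EarlyRise (pullAll ds)
earlyRise-pullAll []       = tt
earlyRise-pullAll (a ∷ ds) = earlyRise-pull a (pullAll ds) (earlyRise-pullAll ds)

-- Pulling changes c only if b ≤ c already, so a run seen after pulling was there before.
pull-∷ : ∀ b c ds → ∃₂ λ c′ es → pull b (c ∷ ds) ≡ c′ ∷ es × (b ≤ c′ → b ≤ c)
pull-∷ b c []       = _ , _ , refl , id
pull-∷ b c (d ∷ ds) with weak? b c d
... | yes (b≤c , _) = _ , _ , refl , λ _ → b≤c
... | no  _         = _ , _ , refl , id

-- Here `t` is the tail already pulled. If a ≤ b ≤ c, pulling overwrites b by c, and pushing writes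
-- a in its place; the last hypothesis, which comes from `LateRise`, says that a is b.
push-pull : ∀ a b t ds → push b t ≡ ds → (∀ c es → t ≡ c ∷ es → b ≤ c → a ≤ b → a ≡ b) →
            push a (pull a (b ∷ t)) ≡ b ∷ ds
push-pull a b []       _  refl _ = refl
push-pull a b (c ∷ es) ds eq   h with weak? a b c
... | no ¬w with weak? a b c
...   | yes w = contradiction w ¬w
...   | no  _ = cong (b ∷_) eq
push-pull a b (c ∷ es) ds eq h | yes (a≤b , b≤c) with weak? a c c
...   | no ¬w = contradiction (≤-trans a≤b b≤c , ≤-refl) ¬w
...   | yes _ with h c es refl b≤c a≤b
...     | refl = cong (a ∷_) eq

pushAll-pullAll : ∀ ds → LateRise ds → pushAll (pullAll ds) ≡ ds
pushAll-pullAll []               _       = refl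
pushAll-pullAll (a ∷ [])         _       = refl
pushAll-pullAll (a ∷ b ∷ [])     _       = refl
pushAll-pullAll (a ∷ ds@(b ∷ c ∷ es)) (h , t) =
  cong (a ∷_) (push-pull a b (pull b (pullAll (c ∷ es))) (c ∷ es)
    (List.∷-injectiveʳ (pushAll-pullAll ds t)) same)
  where
  same : ∀ c′ es′ → pull b (pullAll (c ∷ es)) ≡ c′ ∷ es′ → b ≤ c′ → a ≤ b → a ≡ b
  same c′ es′ eq b≤c′ a≤b with pull-∷ b c (pull c (pullAll es))
  ... | _ , _ , eq′ , f with trans (sym eq) eq′
  ... | refl with m≤n⇒m<n∨m≡n a≤b
  ... | inj₂ a≡b = a≡b
  ... | inj₁ a<b = contradiction (a<b , f b≤c′) h

valid-push : ∀ {n a ds} → Valid n ds → Valid n (push a ds)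
valid-push [] = []
valid-push (b≤ ∷ []) = b≤ ∷ []
valid-push {a = a} (_∷_ {d = b} b≤ v@(_∷_ {d = c} _ _))
  with weak? a b c | valid-push {a = a} v | valid-push {a = b} v
... | yes (a≤b , _) | ihᵃ | _   = ≤-trans a≤b b≤ ∷ ihᵃ
... | no  _         | _   | ihᵇ = b≤ ∷ ihᵇ

descents-push : ∀ a ds → descents (a ∷ push a ds) ≡ descents (a ∷ ds)
descents-push a []           = refl
descents-push a (b ∷ [])     = refl
descents-push a (b ∷ c ∷ ds) with weak? a b c | descents-push a (c ∷ ds) | descents-push b (c ∷ ds)
... | no  _           | _   | ihᵇ = cong (ind (b <? a) +_) ihᵇ
... | yes (a≤b , b≤c) | ihᵃ | _   = cong₂ _+_
  (trans (ind-no (a <? a) (<-irrefl refl)) (sym (ind-no (b <? a) (≤⇒≯ a≤b))))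
  (trans ihᵃ
    (cong (_+ descents (c ∷ ds)) (trans (ind-no (c <? a) (≤⇒≯ (≤-trans a≤b b≤c))) (sym (ind-no (c <? b) (≤⇒≯ b≤c))))))

push-∷ : ∀ b c ds → ∃₂ λ c′ es → push b (c ∷ ds) ≡ c′ ∷ es × (b ≤ c′ → b ≤ c)
push-∷ b c []       = _ , _ , refl , id
push-∷ b c (d ∷ ds) with weak? b c d
... | yes (b≤c , _) = _ , _ , refl , λ _ → b≤c
... | no  _         = _ , _ , refl , id

lateRise-push : ∀ a ds → LateRise (a ∷ push a ds)
lateRise-push a []           = tt
lateRise-push a (b ∷ [])     = tt
lateRise-push a (b ∷ c ∷ ds) with weak? a b c | lateRise-push a (c ∷ ds) | lateRise-push b (c ∷ ds)
... | yes _ | t | _ with push a (c ∷ ds) | push-∷ a c ds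
...   | _ | c′ , es , refl , _ = (λ (a<a , _) → <-irrefl refl a<a) , t
lateRise-push a (b ∷ c ∷ ds) | no ¬w | _ | t with push b (c ∷ ds) | push-∷ b c ds
...   | _ | c′ , es , refl , f = (λ (a<b , b≤c′) → ¬w (<⇒≤ a<b , f b≤c′)) , t

-- Once b has been overwritten by a, pushing goes on as if b were absent; the induction hypothesis
-- of `pullAll-push` is needed for that shorter list.
earlyRise-skip : ∀ a {b c} ds → b ≤ c → EarlyRise (b ∷ c ∷ ds) → EarlyRise (a ∷ c ∷ ds)
earlyRise-skip a []       b≤c _       = tt
earlyRise-skip a (d ∷ ds) b≤c (h , t) = (λ (_ , c<d) → h (b≤c , c<d)) , t

pullAll-push : ∀ a ds → EarlyRise (a ∷ ds) → pull a (pullAll (push a ds)) ≡ ds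
pullAll-push a []       _ = refl
pullAll-push a (b ∷ []) _ = refl
pullAll-push a (b ∷ c ∷ ds) (h , t)
  with weak? a b c | (λ b≤c → pullAll-push a (c ∷ ds) (earlyRise-skip a ds b≤c t)) | pullAll-push b (c ∷ ds) t
... | yes (a≤b , b≤c) | ihᵃ | _ rewrite ihᵃ b≤c with weak? a a c
...   | no ¬w = contradiction (≤-refl , ≤-trans a≤b b≤c) ¬w
-- Pulling restores c where b stood, and these agree because an early rise excludes a ≤ b < c.
...   | yes _ = cong (_∷ c ∷ ds) (≤-antisym (≮⇒≥ λ b<c → h (a≤b , b<c)) b≤c)
pullAll-push a (b ∷ c ∷ ds) (h , t) | no ¬w | _ | ihᵇ rewrite ihᵇ with weak? a b c
... | yes w = contradiction w ¬w
... | no  _ = refl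

lateRise-≼-earlyRise : LateRise ≼ EarlyRise
lateRise-≼-earlyRise = ≼-by pullAll pushAll
  (λ {_} {ds} v _ → valid-pullAll v , earlyRise-pullAll ds , descents-pullAll ds)
  (λ {_} {ds} _ s → pushAll-pullAll ds s)

earlyRise-≼-lateRise : EarlyRise ≼ LateRise
earlyRise-≼-lateRise = ≼-by pushAll pullAll image inverse
  where
  image : ∀ {n ds} → Valid n ds → EarlyRise ds →
          Valid n (pushAll ds) × LateRise (pushAll ds) × descents (pushAll ds) ≡ descents ds
  image []                     _ = [] , tt , refl
  image (_∷_ {d = a} {ds} a≤ v) _ = a≤ ∷ valid-push v , lateRise-push a ds , descents-push a ds
  inverse : ∀ {n ds} → Valid n ds → EarlyRise ds → pullAll (pushAll ds) ≡ ds
  inverse []                      _ = refl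
  inverse (_∷_ {d = a} {ds} _ _) s = cong (a ∷_) (pullAll-push a ds s)

-- Reverse complements of blocks

shift-injective : ∀ d {x y} → shift d x ≡ shift d y → x ≡ y
shift-injective d {x} {y} eq = ≤-antisym
  (≮⇒≥ λ y<x → <-irrefl (sym eq) (shift-mono-< d y<x))
  (≮⇒≥ λ x<y → <-irrefl eq (shift-mono-< d x<y))

shift-≤ : ∀ d x → shift d x ≤ suc x
shift-≤ d x with x <? d
... | yes _ = n≤1+n x
... | no  _ = ≤-refl

-- The simplicial identity for coface maps.
shift-shift : ∀ {i j} x → i ≤ j → shift i (shift j x) ≡ shift (suc j) (shift i x)
shift-shift {i} {j} x i≤j with <-≤-connex x j
... | inj₂ j≤x = begin
  shift i (shift j x)       ≡⟨ cong (shift i) (shift-≥ j≤x) ⟩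
  shift i (suc x)           ≡⟨ shift-≥ (m≤n⇒m≤1+n (≤-trans i≤j j≤x)) ⟩
  suc (suc x)               ≡⟨ shift-≥ (s≤s j≤x) ⟨
  shift (suc j) (suc x)     ≡⟨ cong (shift (suc j)) (shift-≥ (≤-trans i≤j j≤x)) ⟨
  shift (suc j) (shift i x) ∎
  where open ≡-Reasoning
... | inj₁ x<j = trans (cong (shift i) (shift-< x<j)) (sym (shift-< (≤-<-trans (shift-≤ i x) (s≤s x<j))))

letters : List ℕ → List ℕ
letters []       = []
letters (d ∷ ds) = d ∷ map (shift d) (letters ds)

letters-injective : ∀ ds es → letters ds ≡ letters es → ds ≡ es
letters-injective []       []       _  = refl
letters-injective (d ∷ ds) (e ∷ es) eq with List.∷-injective eq
... | refl , eqs = cong (d ∷_) (letters-injective ds es (List.map-injective (shift-injective d) eqs))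

data Arrangement : ℕ → List ℕ → Set where
  []  : ∀ {N} → Arrangement N []
  _∷_ : ∀ {N d ds} → d ≤ N → Arrangement N ds → Arrangement (suc N) (d ∷ ds)

letters-< : ∀ {N ds} → Arrangement N ds → All (_< N) (letters ds)
letters-< []        = []
letters-< (_∷_ {d = d} d≤N a) = s≤s d≤N ∷ All.map⁺ (All.map (λ x<N → s≤s (≤-trans (shift-≤ d _) x<N)) (letters-< a))

-- Appends the letter d to a word, as reversal requires. The new letter raises the digits e ≥ d that
-- it passes, while passing a digit e < d removes a smaller value and lowers d itself.
insertLast : ℕ → List ℕ → List ℕ
insertLast d []       = d ∷ []
insertLast d (e ∷ es) with e <? d
... | yes _ = e ∷ insertLast (pred d) es
... | no  _ = suc e ∷ insertLast d es

letters-insertLast : ∀ d es → letters (insertLast d es) ≡ map (shift d) (letters es) ∷ʳ d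
letters-insertLast d []       = refl
letters-insertLast d (e ∷ es) with e <? d
letters-insertLast (suc d) (e ∷ es) | yes e<d = cong (e ∷_) (begin
  map (shift e) (letters (insertLast d es))                  ≡⟨ cong (map (shift e)) (letters-insertLast d es) ⟩
  map (shift e) (map (shift d) (letters es) ∷ʳ d)            ≡⟨ map-++ (shift e) (map (shift d) (letters es)) (d ∷ []) ⟩
  map (shift e) (map (shift d) (letters es)) ∷ʳ shift e d    ≡⟨ cong₂ _∷ʳ_ commute (shift-≥ (s≤s⁻¹ e<d)) ⟩
  map (shift (suc d)) (map (shift e) (letters es)) ∷ʳ suc d  ∎)
  where
  open ≡-Reasoning
  commute : map (shift e) (map (shift d) (letters es)) ≡ map (shift (suc d)) (map (shift e) (letters es))
  commute = trans (sym (map-∘ (letters es)))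
    (trans (List.map-cong (λ x → shift-shift x (s≤s⁻¹ e<d)) (letters es)) (map-∘ (letters es)))
letters-insertLast d (e ∷ es) | no e≮d = cong (suc e ∷_) (begin
  map (shift (suc e)) (letters (insertLast d es))                  ≡⟨ cong (map (shift (suc e))) (letters-insertLast d es) ⟩
  map (shift (suc e)) (map (shift d) (letters es) ∷ʳ d)            ≡⟨ map-++ (shift (suc e)) (map (shift d) (letters es)) (d ∷ []) ⟩
  map (shift (suc e)) (map (shift d) (letters es)) ∷ʳ shift (suc e) d ≡⟨ cong₂ _∷ʳ_ commute (shift-< (s≤s (≮⇒≥ e≮d))) ⟩
  map (shift d) (map (shift e) (letters es)) ∷ʳ d  ∎)
  where
  open ≡-Reasoning
  commute : map (shift (suc e)) (map (shift d) (letters es)) ≡ map (shift d) (map (shift e) (letters es))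
  commute = trans (sym (map-∘ (letters es)))
    (trans (List.map-cong (λ x → sym (shift-shift x (≮⇒≥ e≮d))) (letters es)) (map-∘ (letters es)))

arrangement-insertLast : ∀ {N d es} → d ≤ N → Arrangement N es → Arrangement (suc N) (insertLast d es)
arrangement-insertLast d≤N [] = d≤N ∷ []
arrangement-insertLast {d = d} d≤N (_∷_ {d = e} e≤N a)
  with e <? d | arrangement-insertLast {d = pred d} (pred-mono-≤ d≤N) a | (λ d≤N′ → arrangement-insertLast {d = d} d≤N′ a)
... | yes _   | ih | _  = m≤n⇒m≤1+n e≤N ∷ ih
... | no  e≮d | _  | ih = s≤s e≤N ∷ ih (≤-trans (≮⇒≥ e≮d) e≤N)

length-insertLast : ∀ d es → length (insertLast d es) ≡ suc (length es)
length-insertLast d []       = refl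
length-insertLast d (e ∷ es) with e <? d
... | yes _ = cong suc (length-insertLast (pred d) es)
... | no  _ = cong suc (length-insertLast d es)

mirror : ℕ → ℕ → ℕ
mirror N x = pred N ∸ x

mirror-< : ∀ {N x} → x < N → mirror N x < N
mirror-< {suc N} {x} _ = s≤s (m∸n≤m N x)

mirror-involutive : ∀ {N x} → x < N → mirror N (mirror N x) ≡ x
mirror-involutive {suc N} x<N = m∸[m∸n]≡n (s≤s⁻¹ x<N)

mirror-anti : ∀ {N x y} → x < N → y < N → x < y ⇔ mirror N y < mirror N x
mirror-anti {suc N} {x} {y} x<N y<N = mk⇔ (λ x<y → ∸-monoʳ-< x<y (s≤s⁻¹ y<N)) (λ lt → ≰⇒> λ y≤x → <⇒≱ lt (∸-monoʳ-≤ N y≤x))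

mirror-shift : ∀ {N d x} → d ≤ N → x < N → mirror (suc N) (shift d x) ≡ shift (N ∸ d) (mirror N x)
mirror-shift {suc N} {d} {x} d≤N x<N with <-≤-connex x d
... | inj₁ x<d = begin
  suc N ∸ shift d x            ≡⟨ cong (suc N ∸_) (shift-< x<d) ⟩
  suc N ∸ x                    ≡⟨ +-∸-assoc 1 (s≤s⁻¹ x<N) ⟩
  suc (N ∸ x)                  ≡⟨ shift-≥ (∸-monoʳ-≤ (suc N) x<d) ⟨
  shift (suc N ∸ d) (N ∸ x)    ∎
  where open ≡-Reasoning
... | inj₂ d≤x = begin
  suc N ∸ shift d x            ≡⟨ cong (suc N ∸_) (shift-≥ d≤x) ⟩
  N ∸ x                        ≡⟨ shift-< (≤-trans (≤-reflexive (sym (+-∸-assoc 1 (s≤s⁻¹ x<N)))) (∸-monoʳ-≤ (suc N) d≤x)) ⟨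
  shift (suc N ∸ d) (N ∸ x)    ∎
  where open ≡-Reasoning

flipBlock : ℕ → List ℕ → List ℕ
flipBlock N []       = []
flipBlock N (d ∷ ds) = insertLast (mirror N d) (flipBlock (pred N) ds)

length-flipBlock : ∀ N ds → length (flipBlock N ds) ≡ length ds
length-flipBlock N []       = refl
length-flipBlock N (d ∷ ds) = trans (length-insertLast (mirror N d) (flipBlock (pred N) ds)) (cong suc (length-flipBlock (pred N) ds))

arrangement-flipBlock : ∀ {N ds} → Arrangement N ds → Arrangement N (flipBlock N ds)
arrangement-flipBlock []        = []
arrangement-flipBlock {suc N} (_∷_ {d = d} d≤N a) = arrangement-insertLast (m∸n≤m N d) (arrangement-flipBlock a)

letters-flipBlock : ∀ {N ds} → Arrangement N ds → letters (flipBlock N ds) ≡ reverse (map (mirror N) (letters ds))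
letters-flipBlock [] = refl
letters-flipBlock {suc N} (_∷_ {d = d} {ds} d≤N a) = begin
  letters (insertLast (N ∸ d) (flipBlock N ds))                            ≡⟨ letters-insertLast (N ∸ d) (flipBlock N ds) ⟩
  map (shift (N ∸ d)) (letters (flipBlock N ds)) ∷ʳ (N ∸ d)                ≡⟨ cong (λ w → map (shift (N ∸ d)) w ∷ʳ (N ∸ d)) (letters-flipBlock a) ⟩
  map (shift (N ∸ d)) (reverse (map (mirror N) (letters ds))) ∷ʳ (N ∸ d)   ≡⟨ cong (_∷ʳ (N ∸ d)) (reverse-map (shift (N ∸ d)) (map (mirror N) (letters ds))) ⟩
  reverse (map (shift (N ∸ d)) (map (mirror N) (letters ds))) ∷ʳ (N ∸ d)   ≡⟨ cong (λ w → reverse w ∷ʳ (N ∸ d)) commute ⟩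
  reverse (map (mirror (suc N)) (map (shift d) (letters ds))) ∷ʳ (N ∸ d)   ≡⟨ unfold-reverse (N ∸ d) (map (mirror (suc N)) (map (shift d) (letters ds))) ⟨
  reverse (map (mirror (suc N)) (letters (d ∷ ds)))                        ∎
  where
  open ≡-Reasoning
  commute : map (shift (N ∸ d)) (map (mirror N) (letters ds)) ≡ map (mirror (suc N)) (map (shift d) (letters ds))
  commute = trans (sym (map-∘ (letters ds)))
    (trans (map-cong-local (All.map (λ x<N → sym (mirror-shift d≤N x<N)) (letters-< a))) (map-∘ (letters ds)))

flipBlock-involutive : ∀ {N ds} → Arrangement N ds → flipBlock N (flipBlock N ds) ≡ ds
flipBlock-involutive {N} {ds} a = letters-injective _ _ (begin
  letters (flipBlock N (flipBlock N ds))                     ≡⟨ letters-flipBlock (arrangement-flipBlock a) ⟩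
  reverse (map (mirror N) (letters (flipBlock N ds)))        ≡⟨ cong (λ w → reverse (map (mirror N) w)) (letters-flipBlock a) ⟩
  reverse (map (mirror N) (reverse (map (mirror N) (letters ds)))) ≡⟨ cong reverse (reverse-map (mirror N) (map (mirror N) (letters ds))) ⟩
  reverse (reverse (map (mirror N) (map (mirror N) (letters ds)))) ≡⟨ reverse-involutive _ ⟩
  map (mirror N) (map (mirror N) (letters ds))               ≡⟨ map-∘ (letters ds) ⟨
  map (mirror N ∘ mirror N) (letters ds)                     ≡⟨ map-id-local (All.map mirror-involutive (letters-< a)) ⟩
  letters ds                                                 ∎)
  where open ≡-Reasoning

descents-map-shift : ∀ d w → descents (map (shift d) w) ≡ descents w
descents-map-shift d []          = refl
descents-map-shift d (x ∷ [])    = refl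
descents-map-shift d (x ∷ y ∷ w) =
  cong₂ _+_ (ind-cong (_ <? _) (_ <? _) (mk⇔ (shift-cancel-< d) (shift-mono-< d))) (descents-map-shift d (y ∷ w))

descents-letters : ∀ ds → descents (letters ds) ≡ descents ds
descents-letters []           = refl
descents-letters (a ∷ [])     = refl
descents-letters (a ∷ ds@(b ∷ _)) =
  cong₂ _+_ (ind-cong (_ <? _) (_ <? _) (shift<⇔ a b)) (trans (descents-map-shift a (letters ds)) (descents-letters ds))

descents-∷ʳ : ∀ w x y → descents (w ∷ʳ x ∷ʳ y) ≡ descents (w ∷ʳ x) + ind (y <? x)
descents-∷ʳ []          x y = +-identityʳ _
descents-∷ʳ (v ∷ [])    x y = trans (cong (ind (x <? v) +_) (+-identityʳ _)) (cong (_+ ind (y <? x)) (sym (+-identityʳ _)))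
descents-∷ʳ (v ∷ w@(u ∷ _)) x y = trans (cong (ind (u <? v) +_) (descents-∷ʳ w x y)) (sym (+-assoc (ind (u <? v)) _ _))

-- An adjacent pair x, y becomes `mirror N y`, `mirror N x`: order and places are both exchanged.
descents-mirror : ∀ {N w} → All (_< N) w → descents (reverse (map (mirror N) w)) ≡ descents w
descents-mirror [] = refl
descents-mirror (_ ∷ []) = refl
descents-mirror {N} (_∷_ {x = x} x< ws@(_∷_ {x = y} {w} y< _)) = begin
  descents (reverse (map m (x ∷ y ∷ w)))            ≡⟨ cong descents (unfold-reverse (m x) (map m (y ∷ w))) ⟩
  descents (reverse (map m (y ∷ w)) ∷ʳ m x)         ≡⟨ cong (λ v → descents (v ∷ʳ m x)) (unfold-reverse (m y) (map m w)) ⟩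
  descents (reverse (map m w) ∷ʳ m y ∷ʳ m x)        ≡⟨ descents-∷ʳ (reverse (map m w)) (m y) (m x) ⟩
  descents (reverse (map m w) ∷ʳ m y) + ind (m x <? m y) ≡⟨ cong (λ v → descents v + ind (m x <? m y)) (unfold-reverse (m y) (map m w)) ⟨
  descents (reverse (map m (y ∷ w))) + ind (m x <? m y)  ≡⟨ cong₂ _+_ (descents-mirror ws) (ind-cong (_ <? _) (_ <? _) (⇔-sym (mirror-anti y< x<))) ⟩
  descents (y ∷ w) + ind (y <? x)                   ≡⟨ +-comm (descents (y ∷ w)) _ ⟩
  descents (x ∷ y ∷ w)                              ∎
  where
  open ≡-Reasoning
  m = mirror N

descents-flipBlock : ∀ {N ds} → Arrangement N ds → descents (flipBlock N ds) ≡ descents ds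
descents-flipBlock {N} {ds} a = begin
  descents (flipBlock N ds)                        ≡⟨ descents-letters (flipBlock N ds) ⟨
  descents (letters (flipBlock N ds))              ≡⟨ cong descents (letters-flipBlock a) ⟩
  descents (reverse (map (mirror N) (letters ds))) ≡⟨ descents-mirror (letters-< a) ⟩
  descents (letters ds)                            ≡⟨ descents-letters ds ⟩
  descents ds                                      ∎
  where open ≡-Reasoning

arrangement-head : ∀ {N d ds} → Arrangement N (d ∷ ds) → suc d ≤ N
arrangement-head (d≤N ∷ _) = s≤s d≤N

-- The first maximal digit length R of a code stands for its largest letter.  A flip
-- reverses and complements the block B before it, and treats the rest likewise.
data Flip : List ℕ → List ℕ → Set where
  []    : Flip [] []
  block : ∀ {ds es} B {R S} → Arrangement (length B + length R) B → Flip R S →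
          ds ≡ B ++ length R ∷ R →
          es ≡ flipBlock (length B + length R) B ++ length S ∷ S → Flip ds es

flip-length : ∀ {ds es} → Flip ds es → length es ≡ length ds
flip-length [] = refl
flip-length (block B {R} {S} a f refl refl)
  rewrite length-++ B {length R ∷ R} | length-++ (flipBlock (length B + length R) B) {length S ∷ S}
        | length-flipBlock (length B + length R) B | flip-length f = refl

flip-sym : ∀ {ds es} → Flip ds es → Flip es ds
flip-sym [] = []
flip-sym (block B {R} {S} a f eq eq′) =
  block (flipBlock N B) (subst (λ l → Arrangement l (flipBlock N B)) N≡ (arrangement-flipBlock a)) (flip-sym f) eq′
    (trans eq (cong (_++ length R ∷ R) (trans (sym (flipBlock-involutive a)) (cong (λ l → flipBlock l (flipBlock N B)) N≡))))
  where
  N = length B + length R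
  N≡ : N ≡ length (flipBlock N B) + length S
  N≡ = sym (cong₂ _+_ (length-flipBlock N B) (flip-length f))

-- The bound on B says that none of its digits equals the number of digits after it, whereas the
-- digit `length R` does. So the split is at the first maximal digit.
split-unique : ∀ B B′ {R R′} → Arrangement (length B + length R) B → Arrangement (length B′ + length R′) B′ →
               B ++ length R ∷ R ≡ B′ ++ length R′ ∷ R′ → B ≡ B′ × R ≡ R′
too-long : ∀ b B {R R′} → Arrangement (length (b ∷ B) + length R) (b ∷ B) → length R′ ∷ R′ ≢ b ∷ B ++ length R ∷ R

too-long b B {R} a eq with List.∷-injective eq
... | refl , refl rewrite length-++ B {length R ∷ R} | +-suc (length B) (length R) =
  <-irrefl refl (arrangement-head a)

split-unique []      []        _  _  eq = refl , List.∷-injectiveʳ eq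
split-unique []      (b ∷ B′)  _  a′ eq = contradiction eq (too-long b B′ a′)
split-unique (b ∷ B) []        a  _  eq = contradiction (sym eq) (too-long b B a)
split-unique (b ∷ B) (b′ ∷ B′) (_ ∷ a) (_ ∷ a′) eq with List.∷-injective eq
... | refl , eqs with split-unique B B′ a a′ eqs
... | refl , refl = refl , refl

flip-functional : ∀ {ds es es′} → Flip ds es → Flip ds es′ → es ≡ es′
flip-functional [] [] = refl
flip-functional [] (block [] _ _ () _)
flip-functional [] (block (_ ∷ _) _ _ () _)
flip-functional (block [] _ _ () _) []
flip-functional (block (_ ∷ _) _ _ () _) []
flip-functional (block B a f eq refl) (block B′ a′ f′ eq′ refl) with split-unique B B′ a a′ (trans (sym eq) eq′)
... | refl , refl with flip-functional f f′
... | refl = refl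

flip-injects : Injects Flip
flip-injects f g = flip-functional (flip-sym f) (flip-sym g)

Split : List ℕ → Set
Split ds = ds ≡ [] ⊎ ∃ λ B → ∃₂ λ R S → Arrangement (length B + length R) B × Flip R S × ds ≡ B ++ length R ∷ R

split⇒flip : ∀ {ds} → Split ds → ∃ (Flip ds)
split⇒flip (inj₁ refl)                       = [] , []
split⇒flip (inj₂ (B , R , S , a , f , refl)) = _ , block B a f refl refl

split-valid : ∀ {n ds} → Valid n ds → Split ds
split-valid [] = inj₁ refl
split-valid (_∷_ {d = d} {ds} d≤n v) with m≤n⇒m<n∨m≡n d≤n | split-valid v
... | inj₂ refl | s = inj₂ ([] , ds , _ , [] , proj₂ (split⇒flip s) , cong (_∷ ds) (sym (length-valid v)))
... | inj₁ d<n  | inj₁ refl with length-valid v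
... | refl = contradiction d<n λ ()
split-valid (_∷_ {d = d} {ds} d≤n v) | inj₁ d<n | inj₂ (B , R , S , a , f , refl) =
  inj₂ (d ∷ B , R , S , d≤ ∷ a , f , refl)
  where
  d≤ : d ≤ length B + length R
  d≤ = s≤s⁻¹ (≤-trans d<n (≤-reflexive (trans (sym (length-valid v)) (trans (length-++ B) (+-suc (length B) (length R))))))

flip-total : ∀ {n ds} → Valid n ds → ∃ (Flip ds)
flip-total v = split⇒flip (split-valid v)

valid-++ : ∀ {n N B ds} → Arrangement N B → Valid n ds → N < length B + n → Valid (length B + n) (B ++ ds)
valid-++ []                  v _  = v
valid-++ (_∷_ {N} b≤N a) v lt = ≤-trans b≤N (≤-trans (n≤1+n N) (s≤s⁻¹ lt)) ∷ valid-++ a v (s≤s⁻¹ lt)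

valid-flip : ∀ {ds es} → Flip ds es → Valid (length ds) ds
valid-flip [] = []
valid-flip (block B {R} a f refl refl) =
  subst (λ n → Valid n (B ++ length R ∷ R)) (sym (length-++ B))
    (valid-++ a (≤-refl ∷ valid-flip f) (≤-reflexive (sym (+-suc (length B) (length R)))))

-- The bounds make the last digit of B at most m, so there is no descent at the junction.
descents-++ : ∀ {N} B {m} R → Arrangement N B → N ≤ length B + m → descents (B ++ m ∷ R) ≡ descents B + descents (m ∷ R)
descents-++ []          R _        _   = refl
descents-++ (b ∷ [])    R (_∷_ {N} b≤N _) lt =
  cong (_+ descents (_ ∷ R)) (ind-no (_ <? b) (≤⇒≯ (≤-trans b≤N (s≤s⁻¹ lt))))
descents-++ (b ∷ B@(c ∷ _)) R (_ ∷ a) lt =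
  trans (cong (ind (c <? b) +_) (descents-++ B R a (s≤s⁻¹ lt))) (sym (+-assoc (ind (c <? b)) (descents B) _))

-- A maximal digit is followed by a descent whenever anything follows it.
descents-max : ∀ {n R S} → Valid n R → Valid n S → descents R ≡ descents S →
               descents (length R ∷ R) ≡ descents (length S ∷ S)
descents-max []                          []                          eq = refl
descents-max v@(_∷_ {d = d} d≤ _) w@(_∷_ {d = e} e≤ _) eq =
  cong₂ _+_ (ind-cong (d <? _) (e <? _) (mk⇔ (λ _ → s≤s (valid-head w)) (λ _ → s≤s (valid-head v)))) eq

descents-flip : ∀ {ds es} → Flip ds es → descents es ≡ descents ds
descents-flip [] = refl
descents-flip (block B {R} {S} a f refl refl) = begin
  descents (flipBlock N B ++ length S ∷ S)                ≡⟨ descents-++ (flipBlock N B) S (arrangement-flipBlock a)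
                                                               (≤-reflexive (sym (cong₂ _+_ (length-flipBlock N B) (flip-length f)))) ⟩
  descents (flipBlock N B) + descents (length S ∷ S)      ≡⟨ cong₂ _+_ (descents-flipBlock a) (descents-max (subst (λ n → Valid n S) (flip-length f) (valid-flip (flip-sym f))) (valid-flip f) (descents-flip f)) ⟩
  descents B + descents (length R ∷ R)                    ≡⟨ descents-++ B R a ≤-refl ⟨
  descents (B ++ length R ∷ R)                            ∎
  where
  open ≡-Reasoning
  N = length B + length R

-- Consecutive patterns with a larger letter after them

OnLetters : (ℕ → ℕ → ℕ → Set) → ℕ → ℕ → ℕ → Set
OnLetters P a b c = P a (shift a b) (shift a (shift b c))

Below : ℕ → ℕ → ℕ → ℕ → Set
Below n x y z = x < n × y < n × z < n

-- The largest letter is 2 + r; it comes after a copy of P at the head of the word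
-- just in case the copy consists of smaller letters.
Undominated : (ℕ → ℕ → ℕ → Set) → List ℕ → Set
Undominated P = Triples λ r a b c → ¬ (OnLetters P a b c × OnLetters (Below (2 + r)) a b c)

Free : (ℕ → ℕ → ℕ → Set) → List ℕ → Set
Free P w = ∀ u {x y z} v → w ≡ u ++ x ∷ y ∷ z ∷ v → ¬ P x y z

triples-tail : ∀ {R} a ds → Triples R (a ∷ ds) → Triples R ds
triples-tail a []           _       = tt
triples-tail a (_ ∷ [])     _       = tt
triples-tail a (_ ∷ _ ∷ ds) (_ , t) = t

module _ (P : ℕ → ℕ → ℕ → Set)
         (P-shift : ∀ d {x y z} → P x y z ⇔ P (shift d x) (shift d y) (shift d z)) where

  free-shift : ∀ d w → Free P w ⇔ Free P (map (shift d) w)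
  free-shift d w = mk⇔ f g
    where
    f : Free P w → Free P (map (shift d) w)
    f free u v eq p with map-++⁻ w u eq
      where
      map-++⁻ : ∀ w u {v} → map (shift d) w ≡ u ++ v → ∃₂ λ u′ v′ → w ≡ u′ ++ v′ × map (shift d) v′ ≡ v
      map-++⁻ w       []      eq = [] , w , refl , eq
      map-++⁻ (_ ∷ w) (_ ∷ u) eq with map-++⁻ w u (List.∷-injectiveʳ eq)
      ... | u′ , v′ , refl , eq′ = _ ∷ u′ , v′ , refl , eq′
    ... | u′ , _ ∷ _ ∷ _ ∷ v′ , eq₁ , refl = free u′ v′ eq₁ (from (P-shift d) p)
    g : Free P (map (shift d) w) → Free P w
    g free u v refl p = free (map (shift d) u) (map (shift d) v) (map-++ (shift d) u _) (to (P-shift d) p)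

  free-letters : ∀ ds → Triples (λ _ a b c → ¬ OnLetters P a b c) ds ⇔ Free P (letters ds)
  free-letters []           = mk⇔ (λ _ → λ { [] _ () ; (_ ∷ _) _ () }) _
  free-letters (a ∷ [])     = mk⇔ (λ _ → λ { [] _ () ; (_ ∷ []) _ () ; (_ ∷ _ ∷ _) _ () }) _
  free-letters (a ∷ b ∷ []) = mk⇔ (λ _ → λ { [] _ () ; (_ ∷ []) _ () ; (_ ∷ _ ∷ []) _ () ; (_ ∷ _ ∷ _ ∷ _) _ () }) _
  free-letters (a ∷ ds@(b ∷ c ∷ _)) = ⇔-trans
    (⇔-refl ×-⇔ ⇔-trans (free-letters ds) (free-shift a (letters ds)))
    (mk⇔ (λ (h , t) → cons h t) (λ free → free [] _ refl , λ u v eq → free (a ∷ u) v (cong (a ∷_) eq)))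
    where
    cons : ∀ {x y z w} → ¬ P x y z → Free P (y ∷ z ∷ w) → Free P (x ∷ y ∷ z ∷ w)
    cons h t []      _ refl = h
    cons h t (_ ∷ u) v eq   = t u v (List.∷-injectiveʳ eq)

  -- A triple within B consists of letters below the largest one, which follows, so it must not be a
  -- copy of P. A triple that includes the largest letter has nothing above it. The triples within R
  -- do not see B.
  undominated-++ : ∀ B R → Arrangement (length B + length R) B →
                   Undominated P (B ++ length R ∷ R) ⇔
                   (Triples (λ _ a b c → ¬ OnLetters P a b c) B × Undominated P R)
  undominated-++ [] R _ = mk⇔ (λ t → tt , triples-tail _ R t) (λ (_ , t) → cons R t)
    where
    cons : ∀ R → Undominated P R → Undominated P (length R ∷ R)
    cons []          _ = tt
    cons (_ ∷ [])    _ = tt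
    cons (_ ∷ _ ∷ _) t = (λ (_ , lt , _) → <-irrefl refl lt) , t
  undominated-++ (b ∷ []) R (b≤ ∷ _) = mk⇔
    (λ t → tt , to (undominated-++ [] R []) (triples-tail b _ t) .proj₂)
    (λ (_ , t) → cons R b≤ (from (undominated-++ [] R []) (tt , t)))
    where
    cons : ∀ R → b ≤ length R → Undominated P (length R ∷ R) → Undominated P (b ∷ length R ∷ R)
    cons []      _  _ = tt
    cons (_ ∷ R) b≤ t = (λ (_ , _ , lt , _) → <-irrefl (shift-≥ b≤) lt) , t
  undominated-++ (a ∷ b ∷ []) R (a≤ ∷ b≤ ∷ []) = mk⇔
    (λ (_ , t) → tt , to (undominated-++ (b ∷ []) R (b≤ ∷ [])) t .proj₂)
    (λ (_ , t) → (λ (_ , _ , _ , lt) → <-irrefl (trans (cong (shift a) (shift-≥ b≤)) (shift-≥ a≤)) lt) ,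
                 from (undominated-++ (b ∷ []) R (b≤ ∷ [])) (tt , t))
  undominated-++ (a ∷ B@(b ∷ c ∷ B′)) R (a≤ ∷ arr@(b≤ ∷ c< ∷ _)) = mk⇔
    (λ (h , t) → ((λ p → h (p , below)) , to (undominated-++ B R arr) t .proj₁) , to (undominated-++ B R arr) t .proj₂)
    (λ ((h , t) , u) → (λ (p , _) → h p) , from (undominated-++ B R arr) (t , u))
    where
    r≡ : length (B′ ++ length R ∷ R) ≡ suc (length B′ + length R)
    r≡ = trans (length-++ B′) (+-suc (length B′) (length R))
    -- No digit of the block is maximal, and each `shift` adds at most 1, so all three letters stay
    -- below the largest.
    below : OnLetters (Below (2 + length (B′ ++ length R ∷ R))) a b c
    below rewrite r≡ = s≤s a≤ ,
      s≤s (≤-trans (shift-≤ a b) (s≤s b≤)) ,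
      s≤s (≤-trans (shift-≤ a _) (s≤s (≤-trans (shift-≤ b c) (s≤s c<))))

module _ {P P′ : ℕ → ℕ → ℕ → Set}
         (P-shift  : ∀ d {x y z} → P x y z ⇔ P (shift d x) (shift d y) (shift d z))
         (P′-shift : ∀ d {x y z} → P′ x y z ⇔ P′ (shift d x) (shift d y) (shift d z))
         (P-mirror : ∀ {N x y z} → x < N → y < N → z < N → P′ (mirror N z) (mirror N y) (mirror N x) → P x y z) where

  -- Reverse complement is an involution on words with letters below N, so applying it again carries
  -- a copy of P′ back to a copy of P in w.
  free-mirror : ∀ {N w} → All (_< N) w → Free P w → Free P′ (reverse (map (mirror N) w))
  free-mirror {N} {w} w< free u {x} {y} {z} v eq p′ = bad (All.++⁻ʳ (map m (reverse v)) below) below-eq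
    where
    m = mirror N
    mw< : All (_< N) (map m w)
    mw< = All.map⁺ (All.map (λ {t} t< → mirror-< {N} {t} t<) w<)
    w≡ : w ≡ map m (reverse v) ++ m z ∷ m y ∷ m x ∷ map m (reverse u)
    w≡ = begin
      w                                                        ≡⟨ map-id-local (All.map mirror-involutive w<) ⟨
      map (m ∘ m) w                                            ≡⟨ map-∘ w ⟩
      map m (map m w)                                          ≡⟨ cong (map m) (reverse-involutive (map m w)) ⟨
      map m (reverse (reverse (map m w)))                      ≡⟨ cong (map m ∘ reverse) eq ⟩
      map m (reverse (u ++ x ∷ y ∷ z ∷ v))                     ≡⟨ cong (map m) (reverse-++ u (x ∷ y ∷ z ∷ v)) ⟩
      map m (reverse ((x ∷ y ∷ z ∷ []) ++ v) ++ reverse u)     ≡⟨ cong (λ t → map m (t ++ reverse u)) (reverse-++ (x ∷ y ∷ z ∷ []) v) ⟩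
      map m ((reverse v ++ z ∷ y ∷ x ∷ []) ++ reverse u)       ≡⟨ cong (map m) (++-assoc (reverse v) _ _) ⟩
      map m (reverse v ++ z ∷ y ∷ x ∷ reverse u)               ≡⟨ map-++ m (reverse v) _ ⟩
      map m (reverse v) ++ m z ∷ m y ∷ m x ∷ map m (reverse u) ∎
      where open ≡-Reasoning
    below : All (_< N) (map m (reverse v) ++ m z ∷ m y ∷ m x ∷ map m (reverse u))
    below = subst (All (_< N)) w≡ w<
    below-eq : x < N × y < N × z < N
    below-eq with All.++⁻ʳ u (subst (All (_< N)) eq (All.tabulate λ i → All.lookup mw< (Any.reverse⁻ i)))
    ... | x< ∷ y< ∷ z< ∷ _ = x< , y< , z<
    bad : All (_< N) (m z ∷ m y ∷ m x ∷ map m (reverse u)) → x < N × y < N × z < N → _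
    bad (mz< ∷ my< ∷ mx< ∷ _) (x< , y< , z<) = free (map m (reverse v)) (map m (reverse u)) w≡
      (P-mirror mz< my< mx< (subst₂ (λ s t → P′ s t (m (m z))) (sym (mirror-involutive x<)) (sym (mirror-involutive y<))
                              (subst (P′ x y) (sym (mirror-involutive z<)) p′)))

  undominated-flip : ∀ {ds es} → Flip ds es → Undominated P ds → Undominated P′ es
  undominated-flip [] _ = tt
  undominated-flip (block B {R} {S} a f refl refl) t with to (undominated-++ P P-shift B R a) t
  ... | tB , tR = from (undominated-++ P′ P′-shift (flipBlock N B) S a′)
    (from (free-letters P′ P′-shift (flipBlock N B))
      (subst (Free P′) (sym (letters-flipBlock a)) (free-mirror (letters-< a) (to (free-letters P P-shift B) tB)))
    , undominated-flip f tR)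
    where
    N = length B + length R
    a′ : Arrangement (length (flipBlock N B) + length S) (flipBlock N B)
    a′ = subst (λ l → Arrangement l (flipBlock N B)) (sym (cong₂ _+_ (length-flipBlock N B) (flip-length f))) (arrangement-flipBlock a)

  undominated-≼ : Undominated P ≼ Undominated P′
  undominated-≼ = record { relates = Flip ; injects = flip-injects ; total = total }
    where
    total : ∀ {n ds} → Valid n ds → Undominated P ds →
            ∃ λ es → Valid n es × Undominated P′ es × descents es ≡ descents ds × Flip ds es
    total v u with flip-total v
    ... | es , f = es , subst (λ n → Valid n es) (trans (flip-length f) (length-valid v)) (valid-flip (flip-sym f)) ,
                   undominated-flip f u , descents-flip f , f

-- Complement

complement : ∀ {n} → Word n → Word n
complement = Vec.map opposite

complement-involutive : ∀ {n} (π : Word n) → complement (complement π) ≡ π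
complement-involutive π = trans (sym (Vec.map-∘ opposite opposite π))
  (trans (Vec.map-cong opposite-involutive π) (Vec.map-id π))

opposite-anti : ∀ {n} (i j : Fin n) → i Fin.< j → opposite j Fin.< opposite i
opposite-anti i j i<j = subst₂ _<_ (sym (opposite-prop j)) (sym (opposite-prop i)) (∸-monoʳ-< (s≤s i<j) (toℕ<n j))

opposite-<⇔ : ∀ {n} (i j : Fin n) → i Fin.< j ⇔ opposite j Fin.< opposite i
opposite-<⇔ i j = mk⇔ (opposite-anti i j)
  (λ lt → subst₂ Fin._<_ (opposite-involutive i) (opposite-involutive j) (opposite-anti (opposite j) (opposite i) lt))

contains-complement : ∀ {k n} (ω : Word (2 + k)) (π : Word n) → Contains ω π → Contains (complement ω) (complement π)
contains-complement ω π (p , qc , iso) = p , qc , λ a b →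
  subst₂ _⇔_ (cong₂ Fin._<_ (sym (lookup-map a opposite ω)) (sym (lookup-map b opposite ω)))
             (cong₂ Fin._<_ (sym (eq a)) (sym (eq b)))
    (⇔-trans (⇔-sym (opposite-<⇔ _ _)) (⇔-trans (iso b a) (opposite-<⇔ _ _)))
  where
  eq : ∀ a → lookup (Vec.map (lookup (complement π)) p) a ≡ opposite (lookup (Vec.map (lookup π) p) a)
  eq a = trans (lookup-map a (lookup (complement π)) p)
    (trans (lookup-map (lookup p a) opposite π) (cong opposite (sym (lookup-map a (lookup π) p))))

avoids-complement : ∀ {k n} (ω : Word (2 + k)) (π : Word n) → Avoids ω π → Avoids (complement ω) (complement π)
avoids-complement ω π avoids c = avoids
  (subst₂ Contains (complement-involutive ω) (complement-involutive π) (contains-complement (complement ω) (complement π) c))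

desᵛ-complement : ∀ {m n} (v : Vec (Fin m) (suc n)) → Uniqueᵛ v → desᵛ (Vec.map opposite v) + desᵛ v ≡ n
desᵛ-complement (x ∷ [])    _ = refl
desᵛ-complement (x ∷ y ∷ v) ((x≢y ∷ _) ∷ v!) = trans (interchange (ind (opposite y Fin.<? opposite x)) (desᵛ (Vec.map opposite (y ∷ v))) (ind (y Fin.<? x)) (desᵛ (y ∷ v)))
  (cong₂ _+_ one (desᵛ-complement (y ∷ v) v!))
  where
  one : ind (opposite y Fin.<? opposite x) + ind (y Fin.<? x) ≡ 1
  one = ind-exclusive (opposite y Fin.<? opposite x) (y Fin.<? x)
    (λ lt → <-asym (from (opposite-<⇔ x y) lt))
    (λ y≮x → opposite-anti x y (Fin.≤∧≢⇒< (≮⇒≥ y≮x) x≢y))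

opposite-injective : ∀ {n} {i j : Fin n} → opposite i ≡ opposite j → i ≡ j
opposite-injective {i = i} {j} eq = trans (sym (opposite-involutive i)) (trans (cong opposite eq) (opposite-involutive j))

des-complement : ∀ {n} (π : Word (suc n)) → IsPermutation π → des (complement π) + des π ≡ n
des-complement π π! = trans (cong₂ _+_ (des-desᵛ (complement π)) (des-desᵛ π)) (desᵛ-complement π π!)

#avoiders-complement-≤ : ∀ {k} (ω : Word (2 + k)) n m → #avoiders ω (suc n) m ≤ #avoiders (complement ω) (suc n) (n ∸ m)
#avoiders-complement-≤ ω n m =
  count-≤ {R = λ π ρ → complement ρ ≡ π} (avoiderWithDes? ω m) (avoiderWithDes? (complement ω) (n ∸ m))
    (λ p q → trans (sym p) q) (allVecs-unique (suc n) (suc n)) total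
  where
  total : ∀ {π} → π ∈ allVecs (suc n) (suc n) → AvoiderWithDes ω m π →
          ∃ λ ρ → ρ ∈ allVecs (suc n) (suc n) × AvoiderWithDes (complement ω) (n ∸ m) ρ × complement ρ ≡ π
  total {π} _ (π! , avoids , refl) = complement π , allVecs-complete (suc n) (suc n) (complement π) ,
    (Uniqueᵛ.map⁺ opposite-injective π! , avoids-complement ω π avoids ,
     sym (trans (cong (_∸ des π) (sym (des-complement π π!))) (m+n∸n≡m (des (complement π)) (des π)))) ,
    complement-involutive π

-- For m > n the truncated difference `n ∸ m` is 0 and no longer reflects m, so this range is
-- treated separately.
#avoiders-many-descents : ∀ {k} (ω : Word (2 + k)) n m → n < m → #avoiders ω (suc n) m ≤ 0
#avoiders-many-descents ω n m n<m =
  count-≤ {R = _≡_} (avoiderWithDes? ω m) (avoiderWithDes? ω m) (λ p q → trans p (sym q))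
    {xs = allVecs (suc n) (suc n)} {ys = []} (allVecs-unique (suc n) (suc n)) absurd
  where
  absurd : ∀ {π} → π ∈ allVecs (suc n) (suc n) → AvoiderWithDes ω m π →
           ∃ λ ρ → ρ ∈ [] × AvoiderWithDes ω m ρ × π ≡ ρ
  absurd {π} _ (π! , _ , refl) =
    contradiction (≤-trans (m≤n+m (des π) (des (complement π))) (≤-reflexive (des-complement π π!))) (<⇒≱ n<m)

module _ {k n} {F : Word (2 + k) → ℕ → ℕ}
         (F-complement-≤ : ∀ ω m → F ω m ≤ F (complement ω) (n ∸ m))
         (F-vanishes : ∀ ω m → n < m → F ω m ≤ 0) where

  -- The inequality for ω and the one for its complement close up to a cycle, both complement and m
  -- ↦ n - m being involutions.
  reflects : ∀ ω {m} → m ≤ n → F (complement ω) (n ∸ m) ≡ F ω m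
  reflects ω {m} m≤n = ≤-antisym
    (≤-trans (F-complement-≤ (complement ω) (n ∸ m))
             (≤-reflexive (cong₂ F (complement-involutive ω) (m∸[m∸n]≡n m≤n))))
    (F-complement-≤ ω m)

  complement-of-symmetric : ∀ ω → (∀ {m} → m ≤ n → F ω m ≡ F ω (n ∸ m)) → ∀ m → F (complement ω) m ≡ F ω m
  complement-of-symmetric ω symmetric m with m ≤? n
  ... | no  m≰n = trans (n≤0⇒n≡0 (F-vanishes (complement ω) m (≰⇒> m≰n))) (sym (n≤0⇒n≡0 (F-vanishes ω m (≰⇒> m≰n))))
  ... | yes m≤n = trans (cong (F (complement ω)) (sym (m∸[m∸n]≡n m≤n)))
    (trans (reflects ω (m∸n≤m n m)) (sym (symmetric m≤n)))

  complement-transfer : ∀ ω ω′ → (∀ m → F ω m ≡ F ω′ m) → ∀ m → F (complement ω) m ≡ F (complement ω′) m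
  complement-transfer ω ω′ F≡ m with m ≤? n
  ... | no  m≰n = trans (n≤0⇒n≡0 (F-vanishes (complement ω) m (≰⇒> m≰n)))
                        (sym (n≤0⇒n≡0 (F-vanishes (complement ω′) m (≰⇒> m≰n))))
  ... | yes m≤n = subst (λ j → F (complement ω) j ≡ F (complement ω′) j) (m∸[m∸n]≡n m≤n)
    (trans (reflects ω (m∸n≤m n m)) (trans (F≡ (n ∸ m)) (sym (reflects ω′ (m∸n≤m n m)))))

∼des-complement : ∀ {k} (ω ω′ : Word (2 + k)) → ω ∼des ω′ → complement ω ∼des complement ω′
∼des-complement {k} ω ω′ ω∼ω′ (suc n) m _ =
  complement-transfer {k} {n} {λ ρ j → #avoiders ρ (suc n) j}
    (λ ρ → #avoiders-complement-≤ ρ n) (λ ρ → #avoiders-many-descents ρ n)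
    ω ω′ (λ j → ω∼ω′ (suc n) j (s≤s z≤n)) m

concatMap-unique : ∀ {A B : Set} (f : A → List B) → (∀ x → Unique (f x)) →
                   (∀ {x y z} → z ∈ f x → z ∈ f y → x ≡ y) → ∀ {xs} → Unique xs → Unique (concatMap f xs)
concatMap-unique f f! disjoint []         = []
concatMap-unique f f! disjoint (_∷_ {x = x} {xs} x∉ xs!) =
  Unique.++⁺ (f! x) (concatMap-unique f f! disjoint xs!) disjoint′
  where
  disjoint′ : ∀ {z} → z ∈ f x × z ∈ concatMap f xs → ⊥
  disjoint′ (z∈ , z∈′) with find (∈-concatMap⁻ f {xs = xs} z∈′)
  ... | y , y∈xs , z∈fy = All.lookup x∉ y∈xs (disjoint z∈ z∈fy)

-- Enumerating codes

-- A generating tree: a class of codes closed under dropping the first digit is built by prepending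
-- digits, the admissible ones depending on the code that follows.
module Growth (digitsBefore : List ℕ → List ℕ) (digitsBefore! : ∀ ds → Unique (digitsBefore ds)) where

  extensions : List ℕ → List (List ℕ)
  extensions ds = map (_∷ ds) (digitsBefore ds)

  codes : ℕ → List (List ℕ)
  codes zero    = [] ∷ []
  codes (suc n) = concatMap extensions (codes n)

  codes-unique : ∀ n → Unique (codes n)
  codes-unique zero    = [] ∷ []
  codes-unique (suc n) = concatMap-unique extensions
    (λ ds → Unique.map⁺ List.∷-injectiveˡ (digitsBefore! ds)) disjoint (codes-unique n)
    where
    disjoint : ∀ {ds es fs} → fs ∈ extensions ds → fs ∈ extensions es → ds ≡ es
    disjoint {ds} {es} fs∈ fs∈′ with ∈-map⁻ (_∷ ds) fs∈ | ∈-map⁻ (_∷ es) fs∈′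
    ... | _ , _ , refl | _ , _ , refl = refl

  module _ (S : List ℕ → Set) (S-[] : S [])
           (S-∷ : ∀ {n ds} → Valid n ds → S ds → ∀ d → (d ∈ digitsBefore ds) ⇔ (d ≤ n × S (d ∷ ds)))
           (S-tail : ∀ d ds → S (d ∷ ds) → S ds) where

    codes-sound : ∀ n {ds} → ds ∈ codes n → Valid n ds × S ds
    codes-sound zero    (here refl) = [] , S-[]
    codes-sound (suc n) ds∈ with find (∈-concatMap⁻ extensions {xs = codes n} ds∈)
    ... | es , es∈ , ds∈ext with ∈-map⁻ (_∷ es) ds∈ext | codes-sound n es∈
    ... | d , d∈ , refl | v , s with to (S-∷ v s d) d∈
    ... | d≤n , s′ = d≤n ∷ v , s′

    codes-complete : ∀ {n ds} → Valid n ds → S ds → ds ∈ codes n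
    codes-complete [] _ = here refl
    codes-complete (_∷_ {n} {d} {ds} d≤n v) s =
      ∈-concatMap⁺ extensions (Any.map (λ { refl → ∈-map⁺ (_∷ ds) (from (S-∷ v (S-tail d ds s) d) (d≤n , s)) })
                                (codes-complete v (S-tail d ds s)))

    module _ {k} (ω : Word (2 + k)) (S≈ω : Characterises S ω) (n m : ℕ) where

      private
        R : Word n → List ℕ → Set
        R π ds = ∃ λ e → word e ≡ π × digits e ≡ ds

      #avoiders-≤-codes : #avoiders ω n m ≤ length (filter (λ ds → descents ds ≟ m) (codes n))
      #avoiders-≤-codes = count-≤ {R = R} (avoiderWithDes? ω m) (λ ds → descents ds ≟ m) inj (allVecs-unique n n) tot
        where
        inj : Injects R
        inj (e , refl , eq) (e′ , refl , eq′) = cong word (digits-injective e e′ (trans eq (sym eq′)))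
        tot : ∀ {π} → π ∈ allVecs n n → AvoiderWithDes ω m π → ∃ λ ds → ds ∈ codes n × descents ds ≡ m × R π ds
        tot _ (π! , avoids , des≡m) with encode _ π!
        ... | e , refl = digits e , codes-complete (digits-valid e) (to (S≈ω e) avoids) ,
                         trans (sym (des-word e)) des≡m , e , refl , refl

      codes-≤-#avoiders : length (filter (λ ds → descents ds ≟ m) (codes n)) ≤ #avoiders ω n m
      codes-≤-#avoiders = count-≤ {R = λ ds π → R π ds} (λ ds → descents ds ≟ m) (avoiderWithDes? ω m) inj (codes-unique n) tot
        where
        inj : Injects (λ ds π → R π ds)
        inj (e , eq , refl) (e′ , eq′ , refl) = cong digits (word-injective e e′ (trans eq (sym eq′)))
        tot : ∀ {ds} → ds ∈ codes n → descents ds ≡ m → ∃ λ π → π ∈ allVecs n n × AvoiderWithDes ω m π × R π ds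
        tot ds∈ des≡m with codes-sound n ds∈
        ... | v , s with code v
        ... | e , refl = word e , allVecs-complete n n (word e) ,
          (word-isPermutation e , from (S≈ω e) s , trans (des-word e) des≡m) , e , refl , refl

      #avoiders-codes : #avoiders ω n m ≡ length (filter (λ ds → descents ds ≟ m) (codes n))
      #avoiders-codes = ≤-antisym #avoiders-≤-codes codes-≤-#avoiders

-- 31-2

-- Read from the right, such a code starts with 0 and climbs by at most 1 at each step: one of the
-- standard families counted by the Catalan numbers.
Climb≤1 : List ℕ → Set
Climb≤1 = Pairs λ _ a b → a ≤ suc b

before : List ℕ → List ℕ
before []       = upTo 1
before (b ∷ ds) = upTo (2 + b)

before! : ∀ ds → Unique (before ds)
before! []       = Unique.upTo⁺ 1
before! (b ∷ ds) = Unique.upTo⁺ (2 + b)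

open Growth before before!

climb-∷ : ∀ {n ds} → Valid n ds → Climb≤1 ds → ∀ d → (d ∈ before ds) ⇔ (d ≤ n × Climb≤1 (d ∷ ds))
climb-∷ []        _ d = mk⇔ (λ d∈ → s≤s⁻¹ (∈-upTo⁻ d∈) , tt) (λ (d≤ , _) → ∈-upTo⁺ (s≤s d≤))
climb-∷ (b≤n ∷ _) s d = mk⇔
  (λ d∈ → let d≤ = s≤s⁻¹ (∈-upTo⁻ d∈) in ≤-trans d≤ (s≤s b≤n) , d≤ , s)
  (λ (_ , d≤ , _) → ∈-upTo⁺ (s≤s d≤))

climb-tail : ∀ d ds → Climb≤1 (d ∷ ds) → Climb≤1 ds
climb-tail d []       _       = tt
climb-tail d (_ ∷ ds) (_ , s) = s

-- Of the digits 0,...,v + 1 that may precede v, all but the last create a nondescent; this gives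
-- the recursion its simple form.
nondescents : List ℕ → ℕ
nondescents []           = 0
nondescents (a ∷ [])     = 0
nondescents (a ∷ b ∷ ds) = ind (a ≤? b) + nondescents (b ∷ ds)

descents+nondescents : ∀ a ds → descents (a ∷ ds) + nondescents (a ∷ ds) ≡ length ds
descents+nondescents a []       = refl
descents+nondescents a (b ∷ ds) = trans
  (interchange (ind (b <? a)) (descents (b ∷ ds)) (ind (a ≤? b)) (nondescents (b ∷ ds)))
  (cong₂ _+_ (ind-exclusive (b <? a) (a ≤? b) <⇒≱ ≰⇒>) (descents+nondescents b ds))

-- Counting by nondescents and the Narayana numbers

sumTo : (ℕ → ℕ) → ℕ → ℕ
sumTo f zero    = f 0
sumTo f (suc v) = sumTo f v + f (suc v)

sumTo-upTo : ∀ f v → sum (map f (upTo (suc v))) ≡ sumTo f v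
sumTo-upTo f zero    = +-identityʳ (f 0)
sumTo-upTo f (suc v) = begin
  sum (map f (upTo (2 + v)))                         ≡⟨ cong (sum ∘ map f) (upTo-∷ʳ (suc v)) ⟨
  sum (map f (upTo (suc v) ++ suc v ∷ []))           ≡⟨ cong sum (map-++ f (upTo (suc v)) (suc v ∷ [])) ⟩
  sum (map f (upTo (suc v)) ++ f (suc v) ∷ [])       ≡⟨ sum-++ (map f (upTo (suc v))) (f (suc v) ∷ []) ⟩
  sum (map f (upTo (suc v))) + (f (suc v) + 0)       ≡⟨ cong₂ _+_ (sumTo-upTo f v) (+-identityʳ (f (suc v))) ⟩
  sumTo f v + f (suc v)                              ∎
  where open ≡-Reasoning

sumTo-cong : ∀ {f g} v → (∀ u → u ≤ v → f u ≡ g u) → sumTo f v ≡ sumTo g v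
sumTo-cong zero    f≗g = f≗g 0 z≤n
sumTo-cong (suc v) f≗g = cong₂ _+_ (sumTo-cong v (λ u u≤v → f≗g u (m≤n⇒m≤1+n u≤v))) (f≗g (suc v) ≤-refl)

sumTo-0 : ∀ v → sumTo (λ _ → 0) v ≡ 0
sumTo-0 zero    = refl
sumTo-0 (suc v) = trans (+-identityʳ _) (sumTo-0 v)

sum-map-concatMap : ∀ {A B : Set} (f : B → ℕ) (g : A → List B) xs →
                    sum (map f (concatMap g xs)) ≡ sum (map (λ x → sum (map f (g x))) xs)
sum-map-concatMap f g []       = refl
sum-map-concatMap f g (x ∷ xs) = begin
  sum (map f (g x ++ concatMap g xs))                  ≡⟨ cong sum (map-++ f (g x) (concatMap g xs)) ⟩
  sum (map f (g x) ++ map f (concatMap g xs))          ≡⟨ sum-++ (map f (g x)) _ ⟩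
  sum (map f (g x)) + sum (map f (concatMap g xs))     ≡⟨ cong (sum (map f (g x)) +_) (sum-map-concatMap f g xs) ⟩
  sum (map (λ x → sum (map f (g x))) (x ∷ xs))         ∎
  where open ≡-Reasoning

length-filter-sum : ∀ {A : Set} {P : A → Set} (P? : ∀ x → Dec (P x)) xs → length (filter P? xs) ≡ sum (map (λ x → ind (P? x)) xs)
length-filter-sum P? []       = refl
length-filter-sum P? (x ∷ xs) = trans (length-filter-∷ P? x xs) (cong (ind (P? x) +_) (length-filter-sum P? xs))

weight : (ℕ → ℕ → ℕ) → List ℕ → ℕ
weight f []         = 0
weight f ds@(v ∷ _) = f (nondescents ds) v

-- The transfer operator of the generating tree, acting on weights: it sums f over the extensions of
-- a code with k nondescents and first digit v. The last term is the digit v + 1, the only one that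
-- makes a descent.
prepend : (ℕ → ℕ → ℕ) → ℕ → ℕ → ℕ
prepend f k v = sumTo (f (suc k)) v + f k (suc v)

weight-extensions : ∀ f v ds → sum (map (weight f) (extensions (v ∷ ds))) ≡ weight (prepend f) (v ∷ ds)
weight-extensions f v ds = begin
  sum (map (weight f) (map (_∷ v ∷ ds) (upTo (2 + v)))) ≡⟨ cong sum (map-∘ {g = weight f} {f = _∷ v ∷ ds} (upTo (2 + v))) ⟨
  sum (map g (upTo (2 + v)))                            ≡⟨ sumTo-upTo g (suc v) ⟩
  sumTo g v + g (suc v)                                 ≡⟨ cong₂ _+_ (sumTo-cong v small) (cong (λ i → f (i + k) (suc v)) (ind-no (suc v ≤? v) 1+n≰n)) ⟩
  prepend f k v                                         ∎
  where
  open ≡-Reasoning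
  k = nondescents (v ∷ ds)
  g : ℕ → ℕ
  g a = f (ind (a ≤? v) + k) a
  small : ∀ a → a ≤ v → g a ≡ f (suc k) a
  small a a≤v = cong (λ i → f (i + k) a) (ind-yes (a ≤? v) a≤v)

total-weight : (ℕ → ℕ → ℕ) → ℕ → ℕ
total-weight f n = sum (map (weight f) (codes (suc n)))

total-weight-suc : ∀ f n → total-weight f (suc n) ≡ total-weight (prepend f) n
total-weight-suc f n = trans (sum-map-concatMap (weight f) extensions (codes (suc n)))
  (cong sum (map-cong-local (All.tabulate step)))
  where
  step : ∀ {ds} → ds ∈ codes (suc n) → sum (map (weight f) (extensions ds)) ≡ weight (prepend f) ds
  step ds∈ with codes-sound Climb≤1 tt climb-∷ climb-tail (suc n) ds∈
  ... | _∷_ {d = v} {ds} _ _ , _ = weight-extensions f v ds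

-- The number of ways to prepend n digits to a code with first digit v that create k
-- nondescents and keep 31-2 avoided.
#prepends : ℕ → ℕ → ℕ → ℕ
#prepends zero    zero    v = 1
#prepends zero    (suc k) v = 0
#prepends (suc n) zero    v = #prepends n 0 (suc v)
#prepends (suc n) (suc k) v = sumTo (#prepends n k) v + #prepends n (suc k) (suc v)

-- This is `#prepends n (K - k) v`, and 0 if k exceeds K: the number of ways to reach K nondescents
-- in total when k are already present.
remaining : ℕ → ℕ → ℕ → ℕ → ℕ
remaining n K       zero    v = #prepends n K v
remaining n zero    (suc k) v = 0
remaining n (suc K) (suc k) v = remaining n K k v

prepend-remaining : ∀ n K k v → prepend (remaining n K) k v ≡ remaining (suc n) K k v
prepend-remaining n zero    zero    v = cong (_+ #prepends n 0 (suc v)) (sumTo-0 v)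
prepend-remaining n (suc K) zero    v = refl
prepend-remaining n zero    (suc k) v = trans (+-identityʳ _) (sumTo-0 v)
prepend-remaining n (suc K) (suc k) v = prepend-remaining n K k v

total-weight-cong : ∀ {f g} → (∀ k v → f k v ≡ g k v) → ∀ n → total-weight f n ≡ total-weight g n
total-weight-cong {f} {g} f≗g n = cong sum (map-cong weight-cong (codes (suc n)))
  where
  weight-cong : ∀ ds → weight f ds ≡ weight g ds
  weight-cong []       = refl
  weight-cong (v ∷ ds) = f≗g _ v

-- Digits are moved one at a time from the enumerated codes to `remaining`, until only the code 0 of
-- length 1 is left.
total-weight-remaining : ∀ i K n → total-weight (remaining i K) n ≡ #prepends (n + i) K 0
total-weight-remaining i K zero    = +-identityʳ (#prepends i K 0)
total-weight-remaining i K (suc n) = begin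
  total-weight (remaining i K) (suc n)        ≡⟨ total-weight-suc (remaining i K) n ⟩
  total-weight (prepend (remaining i K)) n    ≡⟨ total-weight-cong (prepend-remaining i K) n ⟩
  total-weight (remaining (suc i) K) n        ≡⟨ total-weight-remaining (suc i) K n ⟩
  #prepends (n + suc i) K 0                           ≡⟨ cong (λ j → #prepends j K 0) (+-suc n i) ⟩
  #prepends (suc n + i) K 0                           ∎
  where open ≡-Reasoning

remaining-0 : ∀ K k v → remaining 0 K k v ≡ ind (k ≟ K)
remaining-0 zero    zero    v = refl
remaining-0 (suc K) zero    v = refl
remaining-0 zero    (suc k) v = refl
remaining-0 (suc K) (suc k) v = trans (remaining-0 K k v) (ind-cong (k ≟ K) (suc k ≟ suc K) (mk⇔ (cong suc) suc-injective))

count-nondescents : ∀ n K → length (filter (λ ds → nondescents ds ≟ K) (codes (suc n))) ≡ #prepends n K 0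
count-nondescents n K = begin
  length (filter (λ ds → nondescents ds ≟ K) (codes (suc n)))      ≡⟨ length-filter-sum (λ ds → nondescents ds ≟ K) (codes (suc n)) ⟩
  sum (map (λ ds → ind (nondescents ds ≟ K)) (codes (suc n)))      ≡⟨ cong sum (map-cong-local (All.tabulate step)) ⟩
  total-weight (remaining 0 K) n                                   ≡⟨ total-weight-remaining 0 K n ⟩
  #prepends (n + 0) K 0                                                    ≡⟨ cong (λ j → #prepends j K 0) (+-identityʳ n) ⟩
  #prepends n K 0                                                          ∎
  where
  open ≡-Reasoning
  step : ∀ {ds} → ds ∈ codes (suc n) → ind (nondescents ds ≟ K) ≡ weight (remaining 0 K) ds
  step ds∈ with codes-sound Climb≤1 tt climb-∷ climb-tail (suc n) ds∈
  ... | _∷_ {d = v} {ds} _ _ , _ = sym (remaining-0 K (nondescents (v ∷ ds)) v)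

infixl 8 _C⁻_
-- The binomial coefficient with lower index k - 1, which is 0 and not N C 0 for k = 0.
_C⁻_ : ℕ → ℕ → ℕ
N C⁻ zero  = 0
N C⁻ suc k = N C k

pascal : ∀ N k → suc N C suc k ≡ N C k + N C suc k
pascal N k = sym (nCk+nC[k+1]≡[n+1]C[k+1] N k)

pascal⁻ : ∀ N k → suc N C k ≡ N C⁻ k + N C k
pascal⁻ N zero    = refl
pascal⁻ N (suc k) = pascal N k

nC0≡1 : ∀ n → n C 0 ≡ 1
nC0≡1 n = refl

-- #prepends n k v is n C k * (n + v) C k - n C (k + 1) * (n + v) C (k - 1).  At v = 0 it
-- is a Narayana number, and replacing k by n - k only exchanges the factors.
#prepends-closed : ∀ n k v → #prepends n k v + n C suc k * (n + v) C⁻ k ≡ n C k * (n + v) C k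
-- The closed formula summed by the hockey-stick identity; the two boundary terms, both n C k * n C
-- (k + 1), cancel. The additive form avoids truncated subtraction.
sum-#prepends-closed : ∀ n k v → sumTo (#prepends n k) v + n C suc k * (suc (n + v)) C k ≡ n C k * suc (n + v) C suc k

sum-#prepends-closed n k zero rewrite +-identityʳ n | pascal⁻ n k | pascal n k =
  combine (#prepends n k 0) (n C suc k) (n C⁻ k) (n C k) (begin
    #prepends n k 0 + n C suc k * n C⁻ k               ≡⟨ cong (λ N → #prepends n k 0 + n C suc k * N C⁻ k) (+-identityʳ n) ⟨
    #prepends n k 0 + n C suc k * (n + 0) C⁻ k         ≡⟨ #prepends-closed n k 0 ⟩
    n C k * (n + 0) C k                        ≡⟨ cong (λ N → n C k * N C k) (+-identityʳ n) ⟩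
    n C k * n C k                              ∎)
  where
  open ≡-Reasoning
  combine : ∀ a r o q → a + r * o ≡ q * q → a + r * (o + q) ≡ q * (q + r)
  combine a r o q eq = trans (lemma₁ a r o q) (trans (cong (_+ r * q) eq) (lemma₂ q r))
    where
    lemma₁ : ∀ a r o q → a + r * (o + q) ≡ a + r * o + r * q
    lemma₁ = solve-∀
    lemma₂ : ∀ q r → q * q + r * q ≡ q * (q + r)
    lemma₂ = solve-∀
sum-#prepends-closed n k (suc v) with sum-#prepends-closed n k v | #prepends-closed n k (suc v)
... | ihˢ | ihᴬ rewrite +-suc n v | pascal⁻ (suc (n + v)) k | pascal (suc (n + v)) k =
  combine (sumTo (#prepends n k) v) (#prepends n k (suc v)) (n C suc k) (N C⁻ k) (N C k) (n C k) (N C suc k) ihˢ ihᴬ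
  where
  N = suc (n + v)
  combine : ∀ s a r o x q y → s + r * x ≡ q * y → a + r * o ≡ q * x → s + a + r * (o + x) ≡ q * (x + y)
  combine s a r o x q y eq₁ eq₂ = trans (lemma s a r o x) (trans (cong₂ _+_ eq₂ eq₁) (sym (*-distribˡ-+ q x y)))
    where
    lemma : ∀ s a r o x → s + a + r * (o + x) ≡ (a + r * o) + (s + r * x)
    lemma = solve-∀

#prepends-closed zero    zero    v = sym (cong (1 *_) (nC0≡1 v))
#prepends-closed zero    (suc k) v rewrite k>n⇒nCk≡0 {0} {suc k} z<s | k>n⇒nCk≡0 {0} {2 + k} z<s = refl
#prepends-closed (suc n) zero    v = begin
  #prepends n 0 (suc v) + suc n C 1 * 0       ≡⟨ cong (#prepends n 0 (suc v) +_) (*-zeroʳ (suc n C 1)) ⟩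
  #prepends n 0 (suc v) + 0                   ≡⟨ cong (#prepends n 0 (suc v) +_) (*-zeroʳ (n C 1)) ⟨
  #prepends n 0 (suc v) + n C 1 * 0           ≡⟨ #prepends-closed n 0 (suc v) ⟩
  n C 0 * (n + suc v) C 0             ≡⟨ cong₂ _*_ (trans (nC0≡1 n) (sym (nC0≡1 (suc n)))) (trans (nC0≡1 (n + suc v)) (sym (nC0≡1 (suc n + v)))) ⟩
  suc n C 0 * (suc n + v) C 0         ∎
  where open ≡-Reasoning
#prepends-closed (suc n) (suc k) v with sum-#prepends-closed n k v | #prepends-closed n (suc k) (suc v)
... | ihˢ | ihᴬ rewrite +-suc n v | pascal n k | pascal n (suc k) =
  combine (sumTo (#prepends n k) v) (#prepends n (suc k) (suc v)) (n C suc k) (n C (2 + k)) (n C k) (N C k) (N C suc k) ihˢ ihᴬ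
  where
  N = suc (n + v)
  combine : ∀ s a r t q x y → s + r * x ≡ q * y → a + t * x ≡ r * y → s + a + (r + t) * x ≡ (q + r) * y
  combine s a r t q x y eq₁ eq₂ = trans (lemma s a r t x) (trans (cong₂ _+_ eq₁ eq₂) (sym (*-distribʳ-+ y q r)))
    where
    lemma : ∀ s a r t x → s + a + (r + t) * x ≡ (s + r * x) + (a + t * x)
    lemma = solve-∀

-- The symmetry of binomial coefficients; at k = n both sides vanish, by the convention for `_C⁻_`.
C-cross : ∀ {n k} → k ≤ n → n C suc k ≡ n C⁻ (n ∸ k)
C-cross {n} {k} k≤n with m≤n⇒m<n∨m≡n k≤n
... | inj₂ refl rewrite n∸n≡0 n = k>n⇒nCk≡0 (n<1+n n)
... | inj₁ k<n rewrite +-∸-assoc 1 k<n = nCk≡nC[n∸k] k<n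

#prepends-symmetric : ∀ {n k} → k ≤ n → #prepends n (n ∸ k) 0 ≡ #prepends n k 0
#prepends-symmetric {n} {k} k≤n = +-cancelʳ-≡ (n C suc k * n C⁻ k) _ _ (begin
  #prepends n j 0 + n C suc k * n C⁻ k     ≡⟨ cong (#prepends n j 0 +_) (*-comm (n C suc k) (n C⁻ k)) ⟩
  #prepends n j 0 + n C⁻ k * n C suc k     ≡⟨ cong₂ (λ x y → #prepends n j 0 + x * y) (trans (cong (n C⁻_) (sym (m∸[m∸n]≡n k≤n))) (sym (C-cross (m∸n≤m n k)))) (C-cross k≤n) ⟩
  #prepends n j 0 + n C suc j * n C⁻ j     ≡⟨ closed j ⟩
  n C j * n C j                    ≡⟨ cong₂ _*_ (nCk≡nC[n∸k] k≤n) (nCk≡nC[n∸k] k≤n) ⟨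
  n C k * n C k                    ≡⟨ closed k ⟨
  #prepends n k 0 + n C suc k * n C⁻ k     ∎)
  where
  open ≡-Reasoning
  j = n ∸ k
  closed : ∀ k → #prepends n k 0 + n C suc k * n C⁻ k ≡ n C k * n C k
  closed k = subst (λ N → #prepends n k 0 + n C suc k * N C⁻ k ≡ n C k * N C k) (+-identityʳ n) (#prepends-closed n k 0)

count-descents : ∀ {n m} → m ≤ n → length (filter (λ ds → descents ds ≟ m) (codes (suc n))) ≡ #prepends n (n ∸ m) 0
count-descents {n} {m} m≤n = trans (≤-antisym
  (count-≤ {R = _≡_} (λ ds → descents ds ≟ m) (λ ds → nondescents ds ≟ n ∸ m) (λ p q → trans p (sym q)) (codes-unique (suc n))
    λ {ds} ds∈ eq → ds , ds∈ , trans (sym (m+n∸m≡n (descents ds) (nondescents ds))) (cong₂ _∸_ (both ds∈) eq) , refl)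
  (count-≤ {R = _≡_} (λ ds → nondescents ds ≟ n ∸ m) (λ ds → descents ds ≟ m) (λ p q → trans p (sym q)) (codes-unique (suc n))
    λ {ds} ds∈ eq → ds , ds∈ , trans (sym (m+n∸n≡m (descents ds) (nondescents ds))) (trans (cong₂ _∸_ (both ds∈) eq) (m∸[m∸n]≡n m≤n)) , refl))
  (count-nondescents n (n ∸ m))
  where
  both : ∀ {ds} → ds ∈ codes (suc n) → descents ds + nondescents ds ≡ n
  both ds∈ with codes-sound Climb≤1 tt climb-∷ climb-tail (suc n) ds∈
  ... | _∷_ {d = a} {ds} _ v , _ = trans (descents+nondescents a ds) (length-valid v)

module _ {k} (ω : Word (2 + k)) (climb≈ω : Characterises Climb≤1 ω) where

  climb-symmetric : ∀ {n m} → m ≤ n → #avoiders ω (suc n) m ≡ #avoiders ω (suc n) (n ∸ m)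
  climb-symmetric {n} {m} m≤n =
    trans (count m≤n) (trans (sym (#prepends-symmetric (m∸n≤m n m))) (sym (count (m∸n≤m n m))))
    where
    count : ∀ {m} → m ≤ n → #avoiders ω (suc n) m ≡ #prepends n (n ∸ m) 0
    count {m} m≤n = trans (#avoiders-codes Climb≤1 tt climb-∷ climb-tail ω climb≈ω (suc n) m) (count-descents m≤n)

-- Patterns of length 4

Increasing : ∀ {k} → Vec ℕ k → Set
Increasing (x ∷ v@(y ∷ _)) = x < y × Increasing v
Increasing _               = ⊤

increasing-lookup : ∀ {k} (v : Vec ℕ k) → Increasing v → ∀ {i j} → i Fin.< j → lookup v i < lookup v j
increasing-lookup (x ∷ y ∷ v) (x<y , _) {zero}  {suc zero}    _   = x<y
increasing-lookup (x ∷ y ∷ v) (x<y , w) {zero}  {suc (suc j)} _   = <-trans x<y (increasing-lookup (y ∷ v) w {zero} {suc j} z<s)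
increasing-lookup (x ∷ y ∷ v) (_ , w)   {suc i} {suc j}       i<j = increasing-lookup (y ∷ v) w (s≤s⁻¹ i<j)
increasing-lookup (x ∷ [])    _         {zero}  {zero}        ()

lookup-increasing : ∀ {k} (v : Vec ℕ k) → (∀ {i j} → i Fin.< j → lookup v i < lookup v j) → Increasing v
lookup-increasing []          _ = tt
lookup-increasing (x ∷ [])    _ = tt
lookup-increasing (x ∷ y ∷ v) f = f {zero} {suc zero} z<s , lookup-increasing (y ∷ v) (λ i<j → f (s≤s i<j))

InverseOf : ∀ {k} → Word k → Word k → Set
InverseOf ω ρ = (∀ a → lookup ρ (lookup ω a) ≡ a) × (∀ a → lookup ω (lookup ρ a) ≡ a)

-- The inverse of ω lists the positions by increasing letter, so order isomorphism becomes a chain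
-- of inequalities between neighbours in that list.
iso⇔increasing : ∀ {k} (ω ρ : Word k) → InverseOf ω ρ → ∀ v → Isoℕ ω v ⇔ Increasing (Vec.map (lookup v) ρ)
iso⇔increasing ω ρ (ρω , ωρ) v = mk⇔
  (λ i → lookup-increasing (Vec.map (lookup v) ρ) λ {a} {b} a<b →
    subst₂ _<_ (sym (lookup-map a (lookup v) ρ)) (sym (lookup-map b (lookup v) ρ))
      (to (iso i (lookup ρ a) (lookup ρ b)) (subst₂ Fin._<_ (sym (ωρ a)) (sym (ωρ b)) a<b)))
  (λ inc → mkIso λ a b → mk⇔ (forth inc a b) (back inc a b))
  where
  module _ (inc : Increasing (Vec.map (lookup v) ρ)) where
    forth : ∀ a b → lookup ω a Fin.< lookup ω b → lookup v a < lookup v b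
    forth a b lt = subst₂ _<_ (eq a) (eq b) (increasing-lookup (Vec.map (lookup v) ρ) inc lt)
      where
      eq : ∀ a → lookup (Vec.map (lookup v) ρ) (lookup ω a) ≡ lookup v a
      eq a = trans (lookup-map (lookup ω a) (lookup v) ρ) (cong (lookup v) (ρω a))
    back : ∀ a b → lookup v a < lookup v b → lookup ω a Fin.< lookup ω b
    back a b lt with Fin.<-cmp (lookup ω a) (lookup ω b)
    ... | tri< ωa<ωb _ _ = ωa<ωb
    ... | tri> _ _ ωb<ωa = contradiction lt (<-asym (forth b a ωb<ωa))
    ... | tri≈ _ eq _    = contradiction lt (<-irrefl (cong (lookup v) (trans (sym (ρω a)) (trans (cong (lookup ρ) eq) (ρω b)))))

inverse? : ∀ {k} (ω ρ : Word k) → Dec (InverseOf ω ρ)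
inverse? ω ρ = Fin.all? (λ a → lookup ρ (lookup ω a) Fin.≟ a) ×-dec Fin.all? (λ a → lookup ω (lookup ρ a) Fin.≟ a)

module Pattern₄ (ω ρ : Word 4) (ω! : True (isPermutation? ω)) (inv : True (inverse? ω ρ)) where

  Chain : ℕ → ℕ → ℕ → ℕ → Set
  Chain A B C x = Increasing (Vec.map (lookup (A ∷ B ∷ C ∷ x ∷ [])) ρ)

  characterises-by : ∀ {R} → (∀ {r a b c} → a ≤ 2 + r → b ≤ 1 + r → c ≤ r →
                           (¬ ∃ λ x → x < 3 + r × Chain a (shift a b) (shift a (shift b c)) x) ⇔ R r a b c) →
                  Characterises (Triples R) ω
  characterises-by {R} h e = ⇔-trans (characterises₄ ω (toWitness ω!) e) (triples-⇔ h′ (digits-valid e))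
    where
    h′ : ∀ {r a b c} → a ≤ 2 + r → b ≤ 1 + r → c ≤ r → NoHead₄ ω r a b c ⇔ R r a b c
    h′ {r} {a} {b} {c} a≤ b≤ c≤ = ⇔-trans
      (mk⇔ (λ ¬p (x , x< , ch) → ¬p (x , x< , from (iso⇔increasing ω ρ (toWitness inv) _) ch))
           (λ ¬p (x , x< , i) → ¬p (x , x< , to (iso⇔increasing ω ρ (toWitness inv) _) i)))
      (h a≤ b≤ c≤)

-- The letters with digits a, b, c are A = a, B = shift a b and C = shift a (shift b c).
module _ {a b c : ℕ} where

  A<B : a < shift a b ⇔ a ≤ b
  A<B = shift>⇔ a b

  B<C : shift a b < shift a (shift b c) ⇔ b ≤ c
  B<C = ⇔-trans (mk⇔ (shift-cancel-< a) (shift-mono-< a)) (shift>⇔ b c)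

  C<B : shift a (shift b c) < shift a b ⇔ c < b
  C<B = ⇔-trans (mk⇔ (shift-cancel-< a) (shift-mono-< a)) (shift<⇔ b c)

  A<C : a < shift a (shift b c) ⇔ a ≤ shift b c
  A<C = shift>⇔ a (shift b c)

  C<A : shift a (shift b c) < a ⇔ shift b c < a
  C<A = shift<⇔ a (shift b c)

  B≡ : a ≤ b → shift a b ≡ suc b
  B≡ = shift-≥

  C≡-small : c < b → c < a → shift a (shift b c) ≡ c
  C≡-small c<b c<a = trans (cong (shift a) (shift-< c<b)) (shift-< c<a)

  C≡-middle : c < b → a ≤ c → shift a (shift b c) ≡ suc c
  C≡-middle c<b a≤c = trans (cong (shift a) (shift-< c<b)) (shift-≥ a≤c)

  C≡-large : b ≤ c → a ≤ b → shift a (shift b c) ≡ 2 + c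
  C≡-large b≤c a≤b = trans (cong (shift a) (shift-≥ b≤c)) (shift-≥ (m≤n⇒m≤1+n (≤-trans a≤b b≤c)))

-- Digit conditions for eight patterns of length 4

P231 P312 P132 P213 : ℕ → ℕ → ℕ → Set
P231 x y z = z < x × x < y
P312 x y z = y < z × z < x
P132 x y z = x < z × z < y
P213 x y z = y < x × x < z

shift-×⇔ : ∀ d {x y z w} → (x < y × z < w) ⇔ (shift d x < shift d y × shift d z < shift d w)
shift-×⇔ d = mk⇔ (shift-mono-< d) (shift-cancel-< d) ×-⇔ mk⇔ (shift-mono-< d) (shift-cancel-< d)

231≼312 : Undominated P231 ≼ Undominated P312
231≼312 = undominated-≼ {P231} {P312} (λ d → shift-×⇔ d) (λ d → shift-×⇔ d)
  (λ x< y< z< (p , q) → from (mirror-anti z< x<) q , from (mirror-anti x< y<) p)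

312≼231 : Undominated P312 ≼ Undominated P231
312≼231 = undominated-≼ {P312} {P231} (λ d → shift-×⇔ d) (λ d → shift-×⇔ d)
  (λ x< y< z< (p , q) → from (mirror-anti y< z<) q , from (mirror-anti z< x<) p)

132≼213 : Undominated P132 ≼ Undominated P213
132≼213 = undominated-≼ {P132} {P213} (λ d → shift-×⇔ d) (λ d → shift-×⇔ d)
  (λ x< y< z< (p , q) → from (mirror-anti x< z<) q , from (mirror-anti z< y<) p)

213≼132 : Undominated P213 ≼ Undominated P132
213≼132 = undominated-≼ {P213} {P132} (λ d → shift-×⇔ d) (λ d → shift-×⇔ d)
  (λ x< y< z< (p , q) → from (mirror-anti y< x<) q , from (mirror-anti x< z<) p)

-- If any w exceeds the three letters, then so does the largest value 2 + r.
undominated-by : ∀ {r} {P : Set} {x y z : ℕ} {Q : ℕ → Set} →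
                 (∀ w → Q w ⇔ (P × Below w x y z)) →
                 (¬ ∃ λ w → w < 3 + r × Q w) ⇔ (¬ (P × Below (2 + r) x y z))
undominated-by Q⇔ = mk⇔
  (λ ¬p (p , b) → ¬p (_ , ≤-refl , from (Q⇔ _) (p , b)))
  (λ ¬p (w , w< , q) → let (p , x< , y< , z<) = to (Q⇔ w) q ; w≤ = s≤s⁻¹ w< in
                       ¬p (p , <-≤-trans x< w≤ , <-≤-trans y< w≤ , <-≤-trans z< w≤))

w2314 w3124 w2413 w1324 w2134 w1423 w1342 w1243 : Word 4
w2314 = 1F ∷ 2F ∷ 0F ∷ 3F ∷ []
w3124 = 2F ∷ 0F ∷ 1F ∷ 3F ∷ []
w2413 = 1F ∷ 3F ∷ 0F ∷ 2F ∷ []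
w1324 = 0F ∷ 2F ∷ 1F ∷ 3F ∷ []
w2134 = 1F ∷ 0F ∷ 2F ∷ 3F ∷ []
w1423 = 0F ∷ 3F ∷ 1F ∷ 2F ∷ []
w1342 = 0F ∷ 2F ∷ 3F ∷ 1F ∷ []
w1243 = 0F ∷ 1F ∷ 3F ∷ 2F ∷ []

module Pattern2314 = Pattern₄ w2314 (2F ∷ 0F ∷ 1F ∷ 3F ∷ []) _ _
module Pattern3124 = Pattern₄ w3124 (1F ∷ 2F ∷ 0F ∷ 3F ∷ []) _ _
module Pattern2413 = Pattern₄ w2413 (2F ∷ 0F ∷ 3F ∷ 1F ∷ []) _ _
module Pattern1324 = Pattern₄ w1324 (0F ∷ 2F ∷ 1F ∷ 3F ∷ []) _ _
module Pattern2134 = Pattern₄ w2134 (1F ∷ 0F ∷ 2F ∷ 3F ∷ []) _ _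
module Pattern1423 = Pattern₄ w1423 (0F ∷ 2F ∷ 3F ∷ 1F ∷ []) _ _
module Pattern1342 = Pattern₄ w1342 (0F ∷ 3F ∷ 1F ∷ 2F ∷ []) _ _
module Pattern1243 = Pattern₄ w1243 (0F ∷ 1F ∷ 3F ∷ 2F ∷ []) _ _

characterises-2314 : Characterises (Undominated P231) w2314
characterises-2314 = Pattern2314.characterises-by λ _ _ _ → undominated-by λ w → mk⇔
  (λ (p , q , r , _) → (p , q) , <-trans q r , r , <-trans p (<-trans q r))
  (λ ((p , q) , _ , r , _) → p , q , r , tt)

characterises-3124 : Characterises (Undominated P312) w3124
characterises-3124 = Pattern3124.characterises-by λ _ _ _ → undominated-by λ w → mk⇔
  (λ (p , q , r , _) → (p , q) , r , <-trans p (<-trans q r) , <-trans q r)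
  (λ ((p , q) , r , _ , _) → p , q , r , tt)

characterises-1324 : Characterises (Undominated P132) w1324
characterises-1324 = Pattern1324.characterises-by λ _ _ _ → undominated-by λ w → mk⇔
  (λ (p , q , r , _) → (p , q) , <-trans p (<-trans q r) , r , <-trans q r)
  (λ ((p , q) , _ , r , _) → p , q , r , tt)

characterises-2134 : Characterises (Undominated P213) w2134
characterises-2134 = Pattern2134.characterises-by λ _ _ _ → undominated-by λ w → mk⇔
  (λ (p , q , r , _) → (p , q) , <-trans q r , <-trans p (<-trans q r) , r)
  (λ ((p , q) , _ , _ , r) → p , q , r , tt)

module Peaks231 = Peaks (λ a c → c < a) (λ a c → c <? a)
module Peaks132 = Peaks (λ a c → a ≤ c) (λ a c → a ≤? c)

maximal : ℕ → ℕ → ℕ → ℕ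
maximal r a c = suc r

peak231 : ∀ {a b c} → P231 a (shift a b) (shift a (shift b c)) ⇔ Peaks231.Peak a b c
peak231 {a} {b} {c} = mk⇔
  (λ (z<x , x<y) → let a≤b = to (A<B {a} {b} {c}) x<y ; sh<a = to (C<A {a} {b} {c}) z<x ; c<b = to (shift<⇔ b c) (<-≤-trans sh<a a≤b) in
                   c<b , a≤b , subst (_< a) (shift-< c<b) sh<a)
  (λ (c<b , a≤b , c<a) → subst (_< a) (sym (C≡-small c<b c<a)) c<a , from (A<B {a} {b} {c}) a≤b)

peak132 : ∀ {a b c} → P132 a (shift a b) (shift a (shift b c)) ⇔ Peaks132.Peak a b c
peak132 {a} {b} {c} = mk⇔
  (λ (x<z , z<y) → let c<b = to (C<B {a} {b} {c}) z<y ; a≤c = subst (a ≤_) (shift-< c<b) (to (A<C {a} {b} {c}) x<z) in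
                   c<b , ≤-trans a≤c (<⇒≤ c<b) , a≤c)
  (λ (c<b , _ , a≤c) → subst (a <_) (sym (C≡-middle c<b a≤c)) (s≤s a≤c) , from (C<B {a} {b} {c}) c<b)

-- At a peak B = b + 1 is the largest of the three letters. Nothing lies above it exactly when it is
-- 2 + r, that is, when the digit b has its maximal value 1 + r.
undominated⇔maximal : ∀ {r a b c} {P : ℕ → ℕ → ℕ → Set} {Peak : Set} →
  OnLetters P a b c ⇔ Peak → (Peak → a ≤ b × c < b) → b ≤ suc r →
  (¬ (OnLetters P a b c × OnLetters (Below (2 + r)) a b c)) ⇔ (Peak → b ≡ suc r)
undominated⇔maximal {r} {a} {b} {c} {P} {Peak} P⇔ peak b≤ = mk⇔ f g
  where
  f : ¬ (OnLetters P a b c × OnLetters (Below (2 + r)) a b c) → Peak → b ≡ suc r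
  f ¬p pk with m≤n⇒m<n∨m≡n b≤
  ... | inj₂ b≡ = b≡
  ... | inj₁ b< = contradiction (from P⇔ pk , ≤-<-trans a≤b (m≤n⇒m≤1+n b<) , B<2+r , <-trans (from (C<B {a} {b} {c}) c<b) B<2+r) ¬p
    where
    a≤b = proj₁ (peak pk)
    c<b = proj₂ (peak pk)
    B<2+r : shift a b < 2 + r
    B<2+r = s≤s (≤-trans (shift-≤ a b) b<)
  g : (Peak → b ≡ suc r) → ¬ (OnLetters P a b c × OnLetters (Below (2 + r)) a b c)
  g b≡ (p , _ , B< , _) = <-irrefl (trans (B≡ {a} {b} {c} (proj₁ (peak pk))) (cong suc (b≡ pk))) B<
    where pk = to P⇔ p

-- The form comparable with 241-3; `Undominated` is the form comparable with 312-4.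
characterises-2314-peaks : Characterises (Triples (Peaks231.AtHeight maximal)) w2314
characterises-2314-peaks e = ⇔-trans (characterises-2314 e) (triples-⇔
  (λ {r} {a} {b} {c} _ b≤ _ → undominated⇔maximal {r} {a} {b} {c} {P231} peak231 (λ (c<b , a≤b , _) → a≤b , c<b) b≤) (digits-valid e))

characterises-1324-peaks : Characterises (Triples (Peaks132.AtHeight maximal)) w1324
characterises-1324-peaks e = ⇔-trans (characterises-1324 e) (triples-⇔
  (λ {r} {a} {b} {c} _ b≤ _ → undominated⇔maximal {r} {a} {b} {c} {P132} peak132 (λ (c<b , a≤b , _) → a≤b , c<b) b≤) (digits-valid e))

-- At a peak A = a and B = b + 1, so a value fits between them unless b = a; the least candidate is
-- a + 1.
characterises-2413 : Characterises (Triples (Peaks231.AtHeight λ r a c → a)) w2413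
characterises-2413 = Pattern2413.characterises-by λ {r} {a} {b} {c} _ b≤ _ → mk⇔
  (λ ¬p pk@(c<b , a≤b , c<a) → sym (≤-antisym a≤b (≮⇒≥ λ a<b → ¬p (suc a , s≤s (s≤s (≤-trans (n≤1+n a) (≤-trans a<b b≤))) ,
     proj₁ (from (peak231 {a} {b} {c}) pk) , ≤-refl , subst (suc a <_) (sym (B≡ {a} {b} {c} a≤b)) (s≤s a<b) , tt))))
  (λ b≡a (x , _ , C<a , a<x , x<B , _) →
     let pk = to (peak231 {a} {b} {c}) (C<a , <-trans a<x x<B) in
     <⇒≱ a<x (s≤s⁻¹ (subst (x <_) (trans (B≡ {a} {b} {c} (proj₁ (proj₂ pk))) (cong suc (b≡a pk))) x<B)))

-- At a peak C = c + 1 and B = b + 1, so a value fits between them unless b = c + 1; the least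
-- candidate is c + 2.
characterises-1423 : Characterises (Triples (Peaks132.AtHeight λ r a c → suc c)) w1423
characterises-1423 = Pattern1423.characterises-by λ {r} {a} {b} {c} _ b≤ _ → mk⇔
  (λ ¬p pk@(c<b , a≤b , a≤c) → sym (≤-antisym c<b (≮⇒≥ λ 1+c<b → ¬p (2 + c , s≤s (≤-trans 1+c<b (m≤n⇒m≤1+n b≤)) ,
     proj₁ (from (peak132 {a} {b} {c}) pk) , ≤-reflexive (cong suc (C≡-middle c<b a≤c)) ,
     subst (2 + c <_) (sym (B≡ {a} {b} {c} a≤b)) (s≤s 1+c<b) , tt))))
  (λ b≡ (x , _ , a<C , C<x , x<B , _) →
     let pk = to (peak132 {a} {b} {c}) (a<C , <-trans C<x x<B)
         (c<b , a≤b , a≤c) = pk in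
     <⇒≱ (subst (_< x) (C≡-middle c<b a≤c) C<x) (s≤s⁻¹ (subst (x <_) (trans (B≡ {a} {b} {c} a≤b) (cong suc (b≡ pk))) x<B)))

-- Room for a value between A = a and B = b + 1 means a < b, and B < C means b ≤ c.
characterises-1342 : Characterises LateRise w1342
characterises-1342 = Pattern1342.characterises-by λ {r} {a} {b} {c} _ b≤ c≤ → mk⇔
  (λ ¬p (a<b , b≤c) → ¬p (suc a , s≤s (≤-trans a<b (m≤n⇒m≤1+n b≤)) , ≤-refl ,
     subst (suc a <_) (sym (B≡ {a} {b} {c} (<⇒≤ a<b))) (s≤s a<b) , from (B<C {a} {b} {c}) b≤c , tt))
  (λ ¬q (x , _ , a<x , x<B , B<C′ , _) →
     ¬q (<-≤-trans a<x (s≤s⁻¹ (subst (x <_) (B≡ {a} {b} {c} (to (A<B {a} {b} {c}) (<-trans a<x x<B))) x<B)) , to (B<C {a} {b} {c}) B<C′))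

-- In a weakly increasing triple B = b + 1 and C = c + 2, so there is room for a value between them
-- just when b < c; the least candidate is b + 2.
characterises-1243 : Characterises EarlyRise w1243
characterises-1243 = Pattern1243.characterises-by λ {r} {a} {b} {c} _ b≤ c≤ → mk⇔
  (λ ¬p (a≤b , b<c) → ¬p (2 + b , s≤s (s≤s (≤-trans b<c (m≤n⇒m≤1+n c≤))) , from (A<B {a} {b} {c}) a≤b ,
     ≤-reflexive (cong suc (B≡ {a} {b} {c} a≤b)) , subst (2 + b <_) (sym (C≡-large (<⇒≤ b<c) a≤b)) (s≤s (s≤s b<c)) , tt))
  (λ ¬q (x , _ , a<B , B<x , x<C , _) →
     let a≤b = to (A<B {a} {b} {c}) a<B ; b≤c = to (B<C {a} {b} {c}) (<-trans B<x x<C) in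
     ¬q (a≤b , s≤s⁻¹ (<-≤-trans (subst (_< x) (B≡ {a} {b} {c} a≤b) B<x) (s≤s⁻¹ (subst (x <_) (C≡-large b≤c a≤b) x<C)))))

-- Enumerating avoiders of a pattern of length 4

isoℕ? : ∀ {k} (ω : Word k) (v : Vec ℕ k) → Dec (Isoℕ ω v)
isoℕ? ω v = map′ mkIso iso (Fin.all? λ a → Fin.all? λ b →
  (lookup ω a Fin.<? lookup ω b) ⇔-dec (lookup v a <? lookup v b))

module Avoiding₄ (ω : Word 4) where

  HeadAvoids : ℕ → List ℕ → Set
  HeadAvoids a (b ∷ c ∷ ds) = NoHead₄ ω (length ds) a b c
  HeadAvoids a _            = ⊤

  headAvoids? : ∀ a ds → Dec (HeadAvoids a ds)
  headAvoids? a (b ∷ c ∷ ds) = ¬? (anyUpTo? (λ x → isoℕ? ω (a ∷ shift a b ∷ shift a (shift b c) ∷ x ∷ [])) (3 + length ds))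
  headAvoids? a []           = yes tt
  headAvoids? a (_ ∷ [])     = yes tt

  allowed : List ℕ → List ℕ
  allowed ds = filter (λ a → headAvoids? a ds) (upTo (suc (length ds)))

  allowed! : ∀ ds → Unique (allowed ds)
  allowed! ds = Unique.filter⁺ (λ a → headAvoids? a ds) (Unique.upTo⁺ (suc (length ds)))

  module Codes = Growth allowed allowed!

  allowed-∷ : ∀ {n ds} → Valid n ds → Triples (NoHead₄ ω) ds → ∀ a →
              (a ∈ allowed ds) ⇔ (a ≤ n × Triples (NoHead₄ ω) (a ∷ ds))
  allowed-∷ {n} {ds} v t a = mk⇔
    (λ a∈ → let (a∈′ , h) = ∈-filter⁻ (λ a → headAvoids? a ds) a∈ in
             subst (a ≤_) (length-valid v) (s≤s⁻¹ (∈-upTo⁻ a∈′)) , join ds t h)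
    (λ (a≤ , t′) → ∈-filter⁺ (λ a → headAvoids? a ds) (∈-upTo⁺ (s≤s (subst (a ≤_) (sym (length-valid v)) a≤))) (split ds t′))
    where
    join : ∀ ds → Triples (NoHead₄ ω) ds → HeadAvoids a ds → Triples (NoHead₄ ω) (a ∷ ds)
    join []          _ _ = tt
    join (_ ∷ [])    _ _ = tt
    join (_ ∷ _ ∷ _) t h = h , t
    split : ∀ ds → Triples (NoHead₄ ω) (a ∷ ds) → HeadAvoids a ds
    split []          _       = tt
    split (_ ∷ [])    _       = tt
    split (_ ∷ _ ∷ _) (h , _) = h

  module _ (ω! : IsPermutation ω) where

    avoiding-codes : ∀ n m → #avoiders ω n m ≡ length (filter (λ ds → descents ds ≟ m) (Codes.codes n))
    avoiding-codes n m = Codes.#avoiders-codes (Triples (NoHead₄ ω)) tt allowed-∷ tail ω (characterises₄ ω ω!) n m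
      where
      tail : ∀ a ds → Triples (NoHead₄ ω) (a ∷ ds) → Triples (NoHead₄ ω) ds
      tail a []          _       = tt
      tail a (_ ∷ [])    _       = tt
      tail a (_ ∷ _ ∷ _) (_ , t) = t

-- The digit condition for 31-2

pairs-⇔ : ∀ {R R′} → (∀ {r a b} → a ≤ 1 + r → b ≤ r → R r a b ⇔ R′ r a b) →
          ∀ {n ds} → Valid n ds → Pairs R ds ⇔ Pairs R′ ds
pairs-⇔ R⇔R′ [] = ⇔-refl
pairs-⇔ R⇔R′ (_ ∷ []) = ⇔-refl
pairs-⇔ {R} {R′} R⇔R′ (_∷_ {d = a} a≤ v@(_∷_ {d = b} {ds} b≤ w)) =
  subst (λ l → R l a b ⇔ R′ l a b) (sym (length-valid w)) (R⇔R′ a≤ b≤) ×-⇔ pairs-⇔ R⇔R′ v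

w312 w132 : Word 3
w312 = 2F ∷ 0F ∷ 1F ∷ []
w132 = 0F ∷ 2F ∷ 1F ∷ []

-- After a descent the second letter is b itself, and b + 1 is the least candidate for a value
-- between it and a.
characterises-312 : Characterises Climb≤1 w312
characterises-312 e = ⇔-trans (characterises₃ w312 (from-yes (isPermutation? w312)) e) (pairs-⇔ local (digits-valid e))
  where
  iso⇔ : ∀ v → Isoℕ w312 v ⇔ Increasing (Vec.map (lookup v) (1F ∷ 2F ∷ 0F ∷ []))
  iso⇔ = iso⇔increasing w312 (1F ∷ 2F ∷ 0F ∷ []) (from-yes (inverse? w312 (1F ∷ 2F ∷ 0F ∷ [])))
  local : ∀ {r a b} → a ≤ 1 + r → b ≤ r → NoHead₃ w312 r a b ⇔ a ≤ suc b
  local {r} {a} {b} a≤ b≤ = mk⇔ f g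
    where
    f : NoHead₃ w312 r a b → a ≤ suc b
    f ¬p = ≮⇒≥ λ 1+b<a → ¬p (suc b , s≤s (s≤s b≤) ,
      from (iso⇔ (a ∷ shift a b ∷ suc b ∷ []))
        (subst (_< suc b) (sym (shift-< (<-trans (n<1+n b) 1+b<a))) ≤-refl , 1+b<a , tt))
    g : a ≤ suc b → NoHead₃ w312 r a b
    g a≤1+b (x , _ , i) with to (iso⇔ (a ∷ shift a b ∷ x ∷ [])) i
    ... | B<x , x<a , _ = <⇒≱ (≤-<-trans (subst (_< x) (shift-< (to (shift<⇔ a b) (<-trans B<x x<a))) B<x) x<a) a≤1+b

-- A record, so that comparing two equivalences does not unfold #avoiders.
record _≈des_ {k} (ω ω′ : Word (2 + k)) : Set where
  constructor ⟨_⟩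
  field equally-many : _∼des_ {k} {k} ω ω′

open _≈des_

≈des-refl : ∀ {k} {ω : Word (2 + k)} → ω ≈des ω
≈des-refl = ⟨ (λ _ _ _ → refl) ⟩

≈des-sym : ∀ {k} {ω ω′ : Word (2 + k)} → ω ≈des ω′ → ω′ ≈des ω
≈des-sym ⟨ e ⟩ = ⟨ (λ n m 1≤n → sym (e n m 1≤n)) ⟩

≈des-trans : ∀ {k} {ω ω′ ω″ : Word (2 + k)} → ω ≈des ω′ → ω′ ≈des ω″ → ω ≈des ω″
≈des-trans ⟨ e ⟩ ⟨ f ⟩ = ⟨ (λ n m 1≤n → trans (e n m 1≤n) (f n m 1≤n)) ⟩

≈des-complement : ∀ {k} {ω ω′ : Word (2 + k)} → ω ≈des ω′ → complement ω ≈des complement ω′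
≈des-complement {ω = ω} {ω′} ⟨ e ⟩ = ⟨ ∼des-complement ω ω′ e ⟩

climb-complement : ∀ {k} (ω : Word (2 + k)) → Characterises Climb≤1 ω → complement ω ≈des ω
climb-complement {k} ω climb≈ω = ⟨ same ⟩
  where
  same : complement ω ∼des ω
  same (suc n) m _ = complement-of-symmetric {k} {n} {λ ρ j → #avoiders ρ (suc n) j}
    (λ ρ → #avoiders-complement-≤ ρ n) (λ ρ → #avoiders-many-descents ρ n) ω
    (λ {j} → climb-symmetric ω climb≈ω {n} {j}) m

132≈312 : w132 ≈des w312
132≈312 = climb-complement w312 characterises-312

oneLine-injective : ∀ {n} {ω ω′ : Word n} → oneLine ω ≡ oneLine ω′ → ω ≡ ω′
oneLine-injective = map-injective (toℕ-injective ∘ suc-injective) _ _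

-- The classification

module Classification {k} (classes : List (List (Vec ℕ (2 + k))))
  (representative : Fin (length classes) → Word (2 + k))
  (statistic : Fin (length classes) → ℕ × ℕ)
  (n m₁ m₂ : ℕ) (1≤n : 1 ≤ n)
  (statistic-spec : ∀ i → #avoiders (representative i) n m₁ ≡ proj₁ (statistic i) ×
                          #avoiders (representative i) n m₂ ≡ proj₂ (statistic i))
  (statistic-injective : ∀ i j → statistic i ≡ statistic j → i ≡ j)
  (covers : ∀ (ω : Word (2 + k)) → IsPermutation ω → Any (oneLine ω ∈_) classes)
  (members : ∀ i (ω : Word (2 + k)) → oneLine ω ∈ List.lookup classes i → ω ≈des representative i)
  where

  classification : DesWilfClasses k classes
  classification ω ω′ ω! ω′! = mk⇔ separate merge
    where
    merge : SameClass classes ω ω′ → ω ∼des ω′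
    merge same = equally-many (≈des-trans (members i ω (proj₁ both)) (≈des-sym (members i ω′ (proj₂ both))))
      where
      i = index same
      both = Any.lookup-index same
    separate : ω ∼des ω′ → SameClass classes ω ω′
    separate ω∼ω′ = lose (∈-lookup i) (ω∈ , subst (λ l → oneLine ω′ ∈ List.lookup classes l) (sym i≡j) ω′∈)
      where
      i   = index (covers ω ω!)
      j   = index (covers ω′ ω′!)
      ω∈  : oneLine ω ∈ List.lookup classes i
      ω∈  = Any.lookup-index (covers ω ω!)
      ω′∈ : oneLine ω′ ∈ List.lookup classes j
      ω′∈ = Any.lookup-index (covers ω′ ω′!)
      representatives : representative i ≈des representative j
      representatives = ≈des-trans (≈des-sym (members i ω ω∈)) (≈des-trans (⟨_⟩ {ω = ω} {ω′} ω∼ω′) (members j ω′ ω′∈))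
      i≡j : i ≡ j
      i≡j = statistic-injective i j (cong₂ _,_
        (trans (sym (proj₁ (statistic-spec i))) (trans (equally-many representatives n m₁ 1≤n) (proj₁ (statistic-spec j))))
        (trans (sym (proj₂ (statistic-spec i))) (trans (equally-many representatives n m₂ 1≤n) (proj₂ (statistic-spec j)))))

covers? : ∀ {k} (classes : List (List (Vec ℕ (2 + k)))) →
          Dec (All (λ ω → IsPermutation ω → Any (oneLine ω ∈_) classes) (allVecs (2 + k) (2 + k)))
covers? classes = All.all? (λ ω → isPermutation? ω →-dec Any.any? (λ C → oneLine ω ∈? C) classes) (allVecs _ _)
  where open DecMembership (Vec.≡-dec _≟_) using (_∈?_)

all-covered : ∀ {k} (classes : List (List (Vec ℕ (2 + k)))) → True (covers? classes) →
              ∀ (ω : Word (2 + k)) → IsPermutation ω → Any (oneLine ω ∈_) classes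
all-covered {k} classes t ω = All.lookup (toWitness t) (allVecs-complete (2 + k) (2 + k) ω)

separated? : ∀ {n} (f : Fin n → ℕ × ℕ) → Dec (∀ i j → f i ≡ f j → i ≡ j)
separated? f = Fin.all? λ i → Fin.all? λ j → ×-≡-dec _≟_ _≟_ (f i) (f j) →-dec (i Fin.≟ j)

≈des-by-oneLine : ∀ {k} (ω′ : Word (2 + k)) {ω ρ : Word (2 + k)} → ω′ ≈des ρ → oneLine ω ≡ oneLine ω′ → ω ≈des ρ
≈des-by-oneLine ω′ e eq = subst (_≈des _) (sym (oneLine-injective eq)) e

desWilfClasses₂ : DesWilfClasses 0 classes₂
desWilfClasses₂ = Classification.classification classes₂ representative statistic 2 1 1 (s≤s z≤n)
  spec (from-yes (separated? statistic)) (all-covered classes₂ _) members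
  where
  representative : Fin 2 → Word 2
  representative = lookup ((0F ∷ 1F ∷ []) ∷ (1F ∷ 0F ∷ []) ∷ [])
  -- A single number separates the two patterns, so m = 1 is used for both components.
  statistic : Fin 2 → ℕ × ℕ
  statistic = lookup ((1 , 1) ∷ (0 , 0) ∷ [])
  spec : ∀ i → #avoiders (representative i) 2 1 ≡ proj₁ (statistic i) × #avoiders (representative i) 2 1 ≡ proj₂ (statistic i)
  spec 0F = refl , refl
  spec 1F = refl , refl
  members : ∀ i (ω : Word 2) → oneLine ω ∈ List.lookup classes₂ i → ω ≈des representative i
  members 0F ω (here eq) = ≈des-by-oneLine (0F ∷ 1F ∷ []) ≈des-refl eq
  members 1F ω (here eq) = ≈des-by-oneLine (1F ∷ 0F ∷ []) ≈des-refl eq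

desWilfClasses₃ : DesWilfClasses 1 classes₃
desWilfClasses₃ = Classification.classification classes₃ representative statistic 4 1 2 (s≤s z≤n)
  spec (from-yes (separated? statistic)) (all-covered classes₃ _) members
  where
  representative : Fin 5 → Word 3
  representative = lookup ((0F ∷ 1F ∷ 2F ∷ []) ∷ (2F ∷ 1F ∷ 0F ∷ []) ∷ (1F ∷ 0F ∷ 2F ∷ []) ∷ (1F ∷ 2F ∷ 0F ∷ []) ∷ w312 ∷ [])
  -- Complement exchanges one and two descents in 𝔖₄, whence the swapped pairs. The entry (6 , 6) is
  -- from the row 1, 6, 6, 1 of Narayana numbers.
  statistic : Fin 5 → ℕ × ℕ
  statistic = lookup ((3 , 11) ∷ (11 , 3) ∷ (7 , 6) ∷ (6 , 7) ∷ (6 , 6) ∷ [])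
  spec : ∀ i → #avoiders (representative i) 4 1 ≡ proj₁ (statistic i) × #avoiders (representative i) 4 2 ≡ proj₂ (statistic i)
  spec 0F = refl , refl
  spec 1F = refl , refl
  spec 2F = refl , refl
  spec 3F = refl , refl
  spec 4F = refl , refl
  members : ∀ i (ω : Word 3) → oneLine ω ∈ List.lookup classes₃ i → ω ≈des representative i
  members 0F ω (here eq) = ≈des-by-oneLine (representative 0F) ≈des-refl eq
  members 1F ω (here eq) = ≈des-by-oneLine (representative 1F) ≈des-refl eq
  members 2F ω (here eq) = ≈des-by-oneLine (representative 2F) ≈des-refl eq
  members 3F ω (here eq) = ≈des-by-oneLine (representative 3F) ≈des-refl eq
  members 4F ω (here eq) = ≈des-by-oneLine w132 132≈312 eq
  members 4F ω (there (here eq)) = ≈des-by-oneLine w312 ≈des-refl eq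

-- Equivalences and separating numbers in length 4

≈des-from-≼ : ∀ {k} {S T : List ℕ → Set} (ω ω′ : Word (2 + k)) → S ≼ T → T ≼ S →
              Characterises S ω → Characterises T ω′ → ω ≈des ω′
≈des-from-≼ ω ω′ S≼T T≼S S≈ω T≈ω′ = ⟨ ∼des-from-≼ {ω = ω} {ω′} S≼T T≼S S≈ω T≈ω′ ⟩

maximal₂₃₁ : Peaks231.Admissible maximal
maximal₂₃₁ c≤r b≤ (c<b , a≤b , c<a) = (s≤s c≤r , ≤-trans a≤b b≤ , c<a) , ≤-refl

minimal₂₃₁ : Peaks231.Admissible λ r a c → a
minimal₂₃₁ c≤r b≤ (c<b , a≤b , c<a) = (c<a , ≤-refl , c<a) , ≤-trans a≤b b≤

maximal₁₃₂ : Peaks132.Admissible maximal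
maximal₁₃₂ c≤r b≤ (c<b , a≤b , a≤c) = (s≤s c≤r , ≤-trans a≤b b≤ , a≤c) , ≤-refl

minimal₁₃₂ : Peaks132.Admissible λ r a c → suc c
minimal₁₃₂ c≤r b≤ (c<b , a≤b , a≤c) = (≤-refl , m≤n⇒m≤1+n a≤c , a≤c) , s≤s c≤r

3124≈2314 : w3124 ≈des w2314
3124≈2314 = ≈des-from-≼ w3124 w2314 312≼231 231≼312 characterises-3124 characterises-2314

2413≈2314 : w2413 ≈des w2314
2413≈2314 = ≈des-from-≼ w2413 w2314 (Peaks231.atHeight-≼ minimal₂₃₁ maximal₂₃₁) (Peaks231.atHeight-≼ maximal₂₃₁ minimal₂₃₁) characterises-2413 characterises-2314-peaks

2134≈1324 : w2134 ≈des w1324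
2134≈1324 = ≈des-from-≼ w2134 w1324 213≼132 132≼213 characterises-2134 characterises-1324

1423≈1324 : w1423 ≈des w1324
1423≈1324 = ≈des-from-≼ w1423 w1324 (Peaks132.atHeight-≼ minimal₁₃₂ maximal₁₃₂) (Peaks132.atHeight-≼ maximal₁₃₂ minimal₁₃₂) characterises-1423 characterises-1324-peaks

1342≈1243 : w1342 ≈des w1243
1342≈1243 = ≈des-from-≼ w1342 w1243 lateRise-≼-earlyRise earlyRise-≼-lateRise characterises-1342 characterises-1243

representative₄ : Fin 14 → Word 4
representative₄ = lookup
  ( w2314 ∷ w1324 ∷ complement w2314 ∷ complement w1324 ∷ w1243 ∷ complement w1243
  ∷ (0F ∷ 1F ∷ 2F ∷ 3F ∷ []) ∷ (2F ∷ 1F ∷ 0F ∷ 3F ∷ []) ∷ (1F ∷ 0F ∷ 3F ∷ 2F ∷ []) ∷ (3F ∷ 0F ∷ 1F ∷ 2F ∷ [])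
  ∷ (0F ∷ 3F ∷ 2F ∷ 1F ∷ []) ∷ (2F ∷ 3F ∷ 0F ∷ 1F ∷ []) ∷ (1F ∷ 2F ∷ 3F ∷ 0F ∷ []) ∷ (3F ∷ 2F ∷ 1F ∷ 0F ∷ []) ∷ [])

-- Complement exchanges two and three descents in 𝔖₆, so complementary classes have swapped pairs.
-- Either component alone would leave ties, at 218 and at 271.
statistic₄ : Fin 14 → ℕ × ℕ
statistic₄ = lookup
  ( (222 , 263) ∷ (234 , 241) ∷ (263 , 222) ∷ (241 , 234) ∷ (218 , 272) ∷ (272 , 218)
  ∷ (228 , 302) ∷ (279 , 225) ∷ (271 , 218) ∷ (217 , 271)
  ∷ (271 , 217) ∷ (218 , 271) ∷ (225 , 279) ∷ (302 , 228) ∷ [])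

members₄ : ∀ i (ω : Word 4) → oneLine ω ∈ List.lookup classes₄ i → ω ≈des representative₄ i
members₄ 0F ω (here eq)                     = ≈des-by-oneLine w3124 3124≈2314 eq
members₄ 0F ω (there (here eq))             = ≈des-by-oneLine w2314 ≈des-refl eq
members₄ 0F ω (there (there (here eq)))     = ≈des-by-oneLine w2413 2413≈2314 eq
members₄ 1F ω (here eq)                     = ≈des-by-oneLine w2134 2134≈1324 eq
members₄ 1F ω (there (here eq))             = ≈des-by-oneLine w1324 ≈des-refl eq
members₄ 1F ω (there (there (here eq)))     = ≈des-by-oneLine w1423 1423≈1324 eq
members₄ 2F ω (here eq)                     = ≈des-by-oneLine (complement w3124) (≈des-complement 3124≈2314) eq
members₄ 2F ω (there (here eq))             = ≈des-by-oneLine (complement w2314) ≈des-refl eq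
members₄ 2F ω (there (there (here eq)))     = ≈des-by-oneLine (complement w2413) (≈des-complement 2413≈2314) eq
members₄ 3F ω (here eq)                     = ≈des-by-oneLine (complement w2134) (≈des-complement 2134≈1324) eq
members₄ 3F ω (there (here eq))             = ≈des-by-oneLine (complement w1324) ≈des-refl eq
members₄ 3F ω (there (there (here eq)))     = ≈des-by-oneLine (complement w1423) (≈des-complement 1423≈1324) eq
members₄ 4F ω (here eq)                     = ≈des-by-oneLine w1342 1342≈1243 eq
members₄ 4F ω (there (here eq))             = ≈des-by-oneLine w1243 ≈des-refl eq
members₄ 5F ω (here eq)                     = ≈des-by-oneLine (complement w1243) ≈des-refl eq
members₄ 5F ω (there (here eq))             = ≈des-by-oneLine (complement w1342) (≈des-complement 1342≈1243) eq
members₄ i@6F ω (here eq) = ≈des-by-oneLine (representative₄ i) ≈des-refl eq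
members₄ i@7F ω (here eq) = ≈des-by-oneLine (representative₄ i) ≈des-refl eq
members₄ i@8F ω (here eq) = ≈des-by-oneLine (representative₄ i) ≈des-refl eq
members₄ i@9F ω (here eq) = ≈des-by-oneLine (representative₄ i) ≈des-refl eq
members₄ i@(suc 9F) ω (here eq) = ≈des-by-oneLine (representative₄ i) ≈des-refl eq
members₄ i@(suc (suc 9F)) ω (here eq) = ≈des-by-oneLine (representative₄ i) ≈des-refl eq
members₄ i@(suc (suc (suc 9F))) ω (here eq) = ≈des-by-oneLine (representative₄ i) ≈des-refl eq
members₄ i@(suc (suc (suc (suc 9F)))) ω (here eq) = ≈des-by-oneLine (representative₄ i) ≈des-refl eq

descentCounts : ℕ → ℕ → List (List ℕ) → ℕ × ℕ
descentCounts m₁ m₂ codes = length (filter (λ ds → descents ds ≟ m₁) codes) , length (filter (λ ds → descents ds ≟ m₂) codes)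

-- Evaluated on the generating tree, which contains codes of avoiders only, instead of all 6⁶ words.
statistic₄-computed : ∀ i → descentCounts 2 3 (Avoiding₄.Codes.codes (representative₄ i) 6) ≡ statistic₄ i
statistic₄-computed 0F = refl
statistic₄-computed 1F = refl
statistic₄-computed 2F = refl
statistic₄-computed 3F = refl
statistic₄-computed 4F = refl
statistic₄-computed 5F = refl
statistic₄-computed 6F = refl
statistic₄-computed 7F = refl
statistic₄-computed 8F = refl
statistic₄-computed 9F = refl
statistic₄-computed (suc 9F) = refl
statistic₄-computed (suc (suc 9F)) = refl
statistic₄-computed (suc (suc (suc 9F))) = refl
statistic₄-computed (suc (suc (suc (suc 9F)))) = refl

representative₄! : ∀ i → IsPermutation (representative₄ i)
representative₄! = from-yes (Fin.all? λ i → isPermutation? (representative₄ i))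

module _ (n m₁ m₂ : ℕ) where

  counts : (ω : Word 4) → IsPermutation ω → ∀ {s} → descentCounts m₁ m₂ (Avoiding₄.Codes.codes ω n) ≡ s →
           #avoiders ω n m₁ ≡ proj₁ s × #avoiders ω n m₂ ≡ proj₂ s
  counts ω ω! refl = Avoiding₄.avoiding-codes ω ω! n m₁ , Avoiding₄.avoiding-codes ω ω! n m₂

desWilfClasses₄ : DesWilfClasses 2 classes₄
desWilfClasses₄ = Classification.classification classes₄ representative₄ statistic₄ 6 2 3 (s≤s z≤n)
  (λ i → counts 6 2 3 (representative₄ i) (representative₄! i) {statistic₄ i} (statistic₄-computed i))
  (from-yes (separated? statistic₄)) (all-covered classes₄ _) members₄

mainTheorem2 : DesWilfClasses 0 classes₂ × DesWilfClasses 1 classes₃ × DesWilfClasses 2 classes₄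
mainTheorem2 = desWilfClasses₂ , desWilfClasses₃ , desWilfClasses₄
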